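{- Let $n\geq 3$, let $X=\mathbb{R}^n$ or $X=S^n$ (the unit sphere in $\mathbb{R}^{n+1}$), and let $\Gamma=\mathrm{Isom}(X)$. Then there exist uncountable sets $W\subset X$ whose pointwise stabilizer in $\Gamma$ is trivial but for which $P(W)$ (with respect to $\Gamma$ and $2$ colors) does not hold; i.e., there is a precoloring $X\setminus W\to\{R,B\}$ admitting no $\Gamma$-distinguishing extension to $X$. In particular $\mathrm{ext}_D(X,\Gamma)=\infty$.
   Context: Let a group $\Gamma$ act faithfully on a set $X$. A coloring $c:X\to\{R,B\}$ is $\Gamma$-distinguishing if the only $\gamma\in\Gamma$ with $c\circ\gamma=c$ is the identity. For $W\subset X$ whose pointwise stabilizer in $\Gamma$ is trivial, the property $P(W)$ holds if every precoloring $c:X\setminus W\to\{R,B\}$ can be extended to a $\Gamma$-distinguishing coloring $X\to\{R,B\}$. The distinguishing extension number $\mathrm{ext}_D(X,\Gamma)$ is the smallest $m$ such that every $W\subset X$ with $|W|\geq m$ and trivial pointwise stabilizer satisfies $P(W)$ ($\infty$ if none exists). -}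

module Defs where

open import Algebra.Bundles using (Group)
open import Data.Fin using (Fin)
open import Data.Integer.Base as ℤ using (+_)
import Data.Integer.Properties as ℤₚ
open import Data.Nat.Base as ℕ using (ℕ; zero; suc)
import Data.Nat.DivMod as ℕ
import Data.Nat.Properties as ℕₚ
open import Data.Product using (Σ; ∃; _×_; _,_; proj₁; proj₂)
open import Data.Rational.Base as Rat using (ℚ; mkℚ; 0ℚ; 1ℚ; ½; _/_; ∣_∣; toℚᵘ; ↥_; ↧ₙ_)
import Data.Rational.Properties as ℚₚ
open import Data.Rational.Solver using (module +-*-Solver)
open import Data.Rational.Unnormalised.Base as ℚᵘ using (mkℚᵘ)
import Data.Rational.Unnormalised.Properties as ℚᵘₚ
open import Data.Sum using (_⊎_; inj₁; inj₂)
open import Data.Vec.Functional using (Vector; foldr; map; zipWith)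
open import Function.Base using (_∘_)
open import Function.Bundles using (Func; Injection; Surjection; Inverse)
import Function.Construct.Composition as Compose
import Function.Construct.Identity as Identity
import Function.Construct.Symmetry as Symmetry
open import Level using (0ℓ)
open import Relation.Binary.Bundles using (Setoid)
import Relation.Binary.Construct.On as On
open import Relation.Binary.Definitions using (_Respects_)
open import Relation.Binary.PropositionalEquality as ≡ using (_≡_; refl; sym; trans; cong; cong₂; subst; subst₂)
import Relation.Binary.Reasoning.Setoid as SetoidReasoning
open import Relation.Nullary using (¬_; yes; no; contradiction)
open import Relation.Nullary.Construct.Add.Supremum using (_⁺; [_]; ⊤⁺)
open import Relation.Unary using (Pred; ∁; Empty)

record FaithfulAction (Γ : Group 0ℓ 0ℓ) (X : Setoid 0ℓ 0ℓ) : Set where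
  private
    module Γ = Group Γ
    module X = Setoid X
  infixr 7 _·_
  field
    _·_      : Γ.Carrier → X.Carrier → X.Carrier
    ·-cong   : ∀ {γ δ x y} → γ Γ.≈ δ → x X.≈ y → γ · x X.≈ δ · y
    ε-·      : ∀ x → Γ.ε · x X.≈ x
    ∙-·      : ∀ γ δ x → (γ Γ.∙ δ) · x X.≈ γ · δ · x
    faithful : ∀ γ → (∀ x → γ · x X.≈ x) → γ Γ.≈ Γ.ε

record Subset (X : Setoid 0ℓ 0ℓ) : Set₁ where
  open Setoid X using (Carrier; _≈_)
  field
    member   : Pred Carrier 0ℓ
    respects : member Respects _≈_

module _ {X : Setoid 0ℓ 0ℓ} where
  open Setoid X using (Carrier; _≈_)
  open Subset

  restrict : Pred Carrier 0ℓ → Setoid 0ℓ 0ℓ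
  restrict P = On.setoid X (proj₁ {B = P})

  Countable : Subset X → Set
  Countable W = Empty (member W) ⊎ Surjection (≡.setoid ℕ) (restrict (member W))

  Uncountable : Subset X → Set
  Uncountable W = ¬ Countable W

  infix 4 ∣_∣≥_
  ∣_∣≥_ : Subset X → ℕ → Set
  ∣ W ∣≥ m = Injection (≡.setoid (Fin m)) (restrict (member W))

data Color : Set where
  R B : Color

Coloring : Setoid 0ℓ 0ℓ → Set
Coloring X = Func X (≡.setoid Color)

Precoloring : {X : Setoid 0ℓ 0ℓ} → Subset X → Set
Precoloring {X} W = Coloring (restrict {X} (∁ (Subset.member W)))

Extends : {X : Setoid 0ℓ 0ℓ} (W : Subset X) → Coloring X → Precoloring W → Set
Extends W c p = ∀ x (x∉W : ∁ (Subset.member W) x) → Func.to c x ≡ Func.to p (x , x∉W)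

module _ {Γ : Group 0ℓ 0ℓ} {X : Setoid 0ℓ 0ℓ} (A : FaithfulAction Γ X) where
  private
    module Γ = Group Γ
    module X = Setoid X
  open FaithfulAction A
  open Subset

  Distinguishing : Coloring X → Set
  Distinguishing c = ∀ γ → (∀ x → Func.to c (γ · x) ≡ Func.to c x) → γ Γ.≈ Γ.ε

  TrivialPointwiseStabilizer : Subset X → Set
  TrivialPointwiseStabilizer W = ∀ γ → (∀ x → member W x → γ · x X.≈ x) → γ Γ.≈ Γ.ε

  -- Only meaningful when W has trivial pointwise stabilizer, which is a
  -- separate hypothesis wherever P is used.
  P : Subset X → Set
  P W = (p : Precoloring W) → ∃ λ (c : Coloring X) → Extends W c p × Distinguishing c

  -- m is finite: the values of ext_D are natural numbers or ∞.
  ExtensionBound : ℕ → Set₁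
  ExtensionBound m = (W : Subset X) → ∣ W ∣≥ m → TrivialPointwiseStabilizer W → P W

  -- ExtD≡ e expresses ext_D(X,Γ) = e.  It is a relation because the
  -- least bound is not computable from the action.
  ExtD≡ : ℕ ⁺ → Set₁
  ExtD≡ [ m ] = ExtensionBound m × (∀ k → ExtensionBound k → m ℕ.≤ k)
  ExtD≡ ⊤⁺    = ∀ m → ¬ ExtensionBound m

private
  open Rat using (_+_; _*_; _-_; -_; _≤_; _<_)
  open +-*-Solver using (solve; _:+_; _:*_; _:-_; :-_; _:=_; con)

  half-pos : ∀ {ε} → 0ℚ < ε → 0ℚ < ½ * ε
  half-pos {ε} 0<ε = subst (_< ½ * ε) (ℚₚ.*-zeroʳ ½) (ℚₚ.*-monoʳ-<-pos ½ 0<ε)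

  half+half : ∀ ε → ½ * ε + ½ * ε ≡ ε
  half+half = solve 1 (λ e → con ½ :* e :+ con ½ :* e := e) refl

  ∣p-q∣≡∣q-p∣ : ∀ p q → ∣ p - q ∣ ≡ ∣ q - p ∣
  ∣p-q∣≡∣q-p∣ p q = trans (cong ∣_∣ (solve 2 (λ p q → p :- q := :- (q :- p)) refl p q)) (ℚₚ.∣-p∣≡∣p∣ (q - p))

  ∣p-r∣≤ : ∀ p q r → ∣ p - r ∣ ≤ ∣ p - q ∣ + ∣ q - r ∣
  ∣p-r∣≤ p q r = subst (_≤ ∣ p - q ∣ + ∣ q - r ∣)
    (cong ∣_∣ (solve 3 (λ p q r → (p :- q) :+ (q :- r) := p :- r) refl p q r))
    (ℚₚ.∣p+q∣≤∣p∣+∣q∣ (p - q) (q - r))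

  ∣p∣≤∣q∣+ : ∀ p q → ∣ p ∣ ≤ ∣ q ∣ + ∣ p - q ∣
  ∣p∣≤∣q∣+ p q = subst (λ z → ∣ z ∣ ≤ ∣ q ∣ + ∣ p - q ∣)
    (solve 2 (λ p q → q :+ (p :- q) := p) refl p q) (ℚₚ.∣p+q∣≤∣p∣+∣q∣ q (p - q))

  ∣p-p∣≡0 : ∀ p → ∣ p - p ∣ ≡ 0ℚ
  ∣p-p∣≡0 p = cong ∣_∣ (ℚₚ.+-inverseʳ p)

  +-close : ∀ {ε} a b c d → ∣ a - c ∣ < ½ * ε → ∣ b - d ∣ < ½ * ε → ∣ (a + b) - (c + d) ∣ < ε
  +-close {ε} a b c d p q = begin-strict
    ∣ (a + b) - (c + d) ∣   ≡⟨ cong ∣_∣ (solve 4 (λ a b c d → (a :+ b) :- (c :+ d) := (a :- c) :+ (b :- d)) refl a b c d) ⟩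
    ∣ (a - c) + (b - d) ∣   ≤⟨ ℚₚ.∣p+q∣≤∣p∣+∣q∣ (a - c) (b - d) ⟩
    ∣ a - c ∣ + ∣ b - d ∣   <⟨ ℚₚ.+-mono-< p q ⟩
    ½ * ε + ½ * ε           ≡⟨ half+half ε ⟩
    ε                       ∎
    where open ℚₚ.≤-Reasoning

  neg-close : ∀ {ε} a c → ∣ a - c ∣ < ε → ∣ (- a) - (- c) ∣ < ε
  neg-close {ε} a c = subst (_< ε) (trans (∣p-q∣≡∣q-p∣ a c)
    (cong ∣_∣ (solve 2 (λ a c → c :- a := (:- a) :- (:- c)) refl a c)))

  *-tolerance : ∀ {A ε} → 0ℚ < A → 0ℚ < ε → ∃ λ δ → 0ℚ < δ × A * δ + A * δ ≡ ε
  *-tolerance {A} {ε} 0<A 0<ε = δ , 0<δ , eq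
    where
    instance
      A>0 = Rat.positive 0<A
      A≢0 = ℚₚ.pos⇒nonZero A
      1/A>0 = ℚₚ.1/pos⇒pos A
    δ = Rat.1/ A * (½ * ε)
    0<δ : 0ℚ < δ
    0<δ = subst (_< δ) (ℚₚ.*-zeroʳ (Rat.1/ A)) (ℚₚ.*-monoʳ-<-pos (Rat.1/ A) (half-pos 0<ε))
    Aδ : A * δ ≡ ½ * ε
    Aδ = trans (sym (ℚₚ.*-assoc A (Rat.1/ A) (½ * ε)))
           (trans (cong (_* (½ * ε)) (ℚₚ.*-inverseʳ A)) (ℚₚ.*-identityˡ (½ * ε)))
    eq : A * δ + A * δ ≡ ε
    eq = trans (cong₂ _+_ Aδ Aδ) (half+half ε)

  *-close : ∀ {A δ} → 0ℚ < A → ∀ a b c d → ∣ a ∣ ≤ A → ∣ d ∣ ≤ A →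
            ∣ a - c ∣ < δ → ∣ b - d ∣ < δ → ∣ a * b - c * d ∣ < A * δ + A * δ
  *-close {A} {δ} 0<A a b c d a≤A d≤A p q = begin-strict
    ∣ a * b - c * d ∣                       ≡⟨ cong ∣_∣ (solve 4 (λ a b c d → a :* b :- c :* d := a :* (b :- d) :+ d :* (a :- c)) refl a b c d) ⟩
    ∣ a * (b - d) + d * (a - c) ∣           ≤⟨ ℚₚ.∣p+q∣≤∣p∣+∣q∣ (a * (b - d)) (d * (a - c)) ⟩
    ∣ a * (b - d) ∣ + ∣ d * (a - c) ∣       ≡⟨ cong₂ _+_ (ℚₚ.∣p*q∣≡∣p∣*∣q∣ a (b - d)) (ℚₚ.∣p*q∣≡∣p∣*∣q∣ d (a - c)) ⟩
    ∣ a ∣ * ∣ b - d ∣ + ∣ d ∣ * ∣ a - c ∣   ≤⟨ ℚₚ.+-mono-≤ (ℚₚ.*-monoʳ-≤-nonNeg ∣ b - d ∣ {{ℚₚ.∣-∣-nonNeg (b - d)}} a≤A)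
                                                           (ℚₚ.*-monoʳ-≤-nonNeg ∣ a - c ∣ {{ℚₚ.∣-∣-nonNeg (a - c)}} d≤A) ⟩
    A * ∣ b - d ∣ + A * ∣ a - c ∣           <⟨ ℚₚ.+-mono-< (ℚₚ.*-monoʳ-<-pos A q) (ℚₚ.*-monoʳ-<-pos A p) ⟩
    A * δ + A * δ                           ∎
    where
    open ℚₚ.≤-Reasoning
    instance
      A>0 = Rat.positive 0<A

isqrt : ℕ → ℕ
isqrt zero = zero
isqrt (suc k) with suc (isqrt k) ℕ.* suc (isqrt k) ℕₚ.≤? suc k
... | yes _ = suc (isqrt k)
... | no  _ = isqrt k

-- ⌊ √(|q|(n+1)²) ⌋ / (n+1)
sqrtApprox : ℕ → ℚ → ℚ
sqrtApprox n q = + isqrt ((ℤ.∣ ↥ q ∣ ℕ.* (suc n ℕ.* suc n)) ℕ./ ↧ₙ q) / suc n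

isqrt-lower : ∀ k → isqrt k ℕ.* isqrt k ℕ.≤ k
isqrt-lower zero = ℕ.z≤n
isqrt-lower (suc k) with suc (isqrt k) ℕ.* suc (isqrt k) ℕₚ.≤? suc k
... | yes p = p
... | no  _ = ℕₚ.m≤n⇒m≤1+n (isqrt-lower k)

isqrt-upper : ∀ k → k ℕ.< suc (isqrt k) ℕ.* suc (isqrt k)
isqrt-upper zero = ℕ.s≤s ℕ.z≤n
isqrt-upper (suc k) with suc (isqrt k) ℕ.* suc (isqrt k) ℕₚ.≤? suc k
... | yes p = ℕₚ.≤-<-trans (isqrt-upper k) (ℕₚ.*-mono-< (ℕₚ.n<1+n s) (ℕₚ.n<1+n s))
  where s = suc (isqrt k)
... | no ¬p = ℕₚ.≰⇒> ¬p

private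
  toℚᵘ-/ : ∀ i n → toℚᵘ (i / suc n) ℚᵘ.≃ mkℚᵘ i n
  toℚᵘ-/ i n = ℚₚ.toℚᵘ-fromℚᵘ (mkℚᵘ i n)

  toℚᵘ-sq : ∀ i n → toℚᵘ (i / suc n * (i / suc n)) ℚᵘ.≃ mkℚᵘ i n ℚᵘ.* mkℚᵘ i n
  toℚᵘ-sq i n = ℚᵘₚ.≃-trans (ℚₚ.toℚᵘ-homo-* (i / suc n) (i / suc n))
                            (ℚᵘₚ.*-cong (toℚᵘ-/ i n) (toℚᵘ-/ i n))

  /-suc : ∀ j n → + j / suc n + + 1 / suc n ≡ + suc j / suc n
  /-suc j n = ℚₚ.toℚᵘ-injective (begin
    toℚᵘ (+ j / suc n + + 1 / suc n)            ≈⟨ ℚₚ.toℚᵘ-homo-+ (+ j / suc n) (+ 1 / suc n) ⟩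
    toℚᵘ (+ j / suc n) ℚᵘ.+ toℚᵘ (+ 1 / suc n)  ≈⟨ ℚᵘₚ.+-cong (toℚᵘ-/ (+ j) n) (toℚᵘ-/ (+ 1) n) ⟩
    mkℚᵘ (+ j) n ℚᵘ.+ mkℚᵘ (+ 1) n              ≈⟨ ℚᵘ.*≡* eq ⟩
    mkℚᵘ (+ suc j) n                            ≈⟨ toℚᵘ-/ (+ suc j) n ⟨
    toℚᵘ (+ suc j / suc n)                      ∎)
    where
    open SetoidReasoning ℚᵘₚ.≃-setoid
    N = + suc n
    eq : (+ j ℤ.* N ℤ.+ + 1 ℤ.* N) ℤ.* N ≡ + suc j ℤ.* + (suc n ℕ.* suc n)
    eq = trans (cong (ℤ._* N) (sym (ℤₚ.*-distribʳ-+ N (+ j) (+ 1))))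
         (trans (ℤₚ.*-assoc (+ j ℤ.+ + 1) N N)
         (cong₂ ℤ._*_ (cong +_ (ℕₚ.+-comm j 1)) (sym (ℤₚ.pos-* (suc n) (suc n)))))

sqrtApprox-lower : ∀ n q → sqrtApprox n q * sqrtApprox n q ≤ ∣ q ∣
sqrtApprox-lower n (mkℚ i d _) = ℚₚ.toℚᵘ-cancel-≤
  (ℚᵘₚ.≤-respˡ-≃ (ℚᵘₚ.≃-sym (toℚᵘ-sq (+ j) n)) (ℚᵘ.*≤* bound))
  where
  N² = suc n ℕ.* suc n
  a = ℤ.∣ i ∣ ℕ.* N²
  k = a ℕ./ suc d
  j = isqrt k
  bound : (+ j ℤ.* + j) ℤ.* + suc d ℤ.≤ + ℤ.∣ i ∣ ℤ.* + N²
  bound = subst₂ ℤ._≤_ (trans (ℤₚ.pos-* (j ℕ.* j) (suc d)) (cong (ℤ._* + suc d) (ℤₚ.pos-* j j))) (ℤₚ.pos-* ℤ.∣ i ∣ N²)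
    (ℤ.+≤+ (ℕₚ.≤-trans (ℕₚ.*-monoˡ-≤ (suc d) (isqrt-lower k)) (ℕ.m/n*n≤m a (suc d))))

sqrtApprox-upper : ∀ n q → ∣ q ∣ < (sqrtApprox n q + + 1 / suc n) * (sqrtApprox n q + + 1 / suc n)
sqrtApprox-upper n (mkℚ i d c) = subst (λ t → ∣ mkℚ i d c ∣ < t * t) (sym (/-suc j n))
  (ℚₚ.toℚᵘ-cancel-< (ℚᵘₚ.<-respʳ-≃ (ℚᵘₚ.≃-sym (toℚᵘ-sq (+ suc j) n)) (ℚᵘ.*<* bound)))
  where
  N² = suc n ℕ.* suc n
  a = ℤ.∣ i ∣ ℕ.* N²
  k = a ℕ./ suc d
  j = isqrt k
  a<[1+k]d : a ℕ.< suc k ℕ.* suc d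
  a<[1+k]d = subst (ℕ._< suc k ℕ.* suc d) (sym (ℕ.m≡m%n+[m/n]*n a (suc d)))
    (ℕₚ.+-monoˡ-< (k ℕ.* suc d) (ℕ.m%n<n a (suc d)))
  bound : + ℤ.∣ i ∣ ℤ.* + N² ℤ.< (+ suc j ℤ.* + suc j) ℤ.* + suc d
  bound = subst₂ ℤ._<_ (ℤₚ.pos-* ℤ.∣ i ∣ N²)
    (trans (ℤₚ.pos-* (suc j ℕ.* suc j) (suc d)) (cong (ℤ._* + suc d) (ℤₚ.pos-* (suc j) (suc j))))
    (ℤ.+<+ (ℕₚ.<-≤-trans a<[1+k]d (ℕₚ.*-monoˡ-≤ (suc d) (isqrt-upper k))))

sqrtApprox-nonNeg : ∀ n q → 0ℚ ≤ sqrtApprox n q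
sqrtApprox-nonNeg n q = ℚₚ.nonNegative⁻¹ (sqrtApprox n q)
  {{ℚₚ.normalize-nonNeg (isqrt ((ℤ.∣ ↥ q ∣ ℕ.* (suc n ℕ.* suc n)) ℕ./ ↧ₙ q)) (suc n)}}

private
  1/n-small : ∀ {e} → 0ℚ < e → ∃ λ N → ∀ n → N ℕ.≤ n → + 1 / suc n ≤ e
  1/n-small {e@(mkℚ (+ zero) d c)} (Rat.*<* (ℤ.+<+ ()))
  1/n-small {e@(mkℚ ℤ.-[1+ _ ] d c)} (Rat.*<* ())
  1/n-small {e@(mkℚ (+ suc p) d c)} _ = suc d , λ n d<n → ℚₚ.toℚᵘ-cancel-≤
    (ℚᵘₚ.≤-respˡ-≃ (ℚᵘₚ.≃-sym (toℚᵘ-/ (+ 1) n)) (ℚᵘ.*≤* (bound n d<n)))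
    where
    bound : ∀ n → suc d ℕ.≤ n → + 1 ℤ.* + suc d ℤ.≤ + suc p ℤ.* + suc n
    bound n d<n = subst₂ ℤ._≤_ (ℤₚ.pos-* 1 (suc d)) (ℤₚ.pos-* (suc p) (suc n))
      (ℤ.+≤+ (ℕₚ.*-mono-≤ (ℕ.s≤s (ℕ.z≤n {p})) (ℕₚ.m≤n⇒m≤1+n d<n)))

  sq-mono-≤ : ∀ {p q} → 0ℚ ≤ p → p ≤ q → p * p ≤ q * q
  sq-mono-≤ {p} {q} 0≤p p≤q = ℚₚ.≤-trans
    (ℚₚ.*-monoˡ-≤-nonNeg p {{Rat.nonNegative 0≤p}} p≤q)
    (ℚₚ.*-monoʳ-≤-nonNeg q {{Rat.nonNegative (ℚₚ.≤-trans 0≤p p≤q)}} p≤q)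

  0≤+ : ∀ {p q} → 0ℚ ≤ p → 0ℚ ≤ q → 0ℚ ≤ p + q
  0≤+ 0≤p 0≤q = ℚₚ.+-mono-≤ 0≤p 0≤q

  root-close : ∀ {e} → 0ℚ < e → ∀ s t h a b → 0ℚ ≤ t → 0ℚ ≤ h → h ≤ e →
                s * s ≤ ∣ a ∣ → ∣ b ∣ < (t + h) * (t + h) → ∣ a - b ∣ < e * e → s - t < e + e
  root-close {e} 0<e s t h a b 0≤t 0≤h h≤e lower upper close = ℚₚ.≰⇒> λ p → ℚₚ.<-irrefl refl (impossible p)
    where
    open ℚₚ.≤-Reasoning
    0≤e = ℚₚ.<⇒≤ 0<e
    w = t + (e + e)
    w≤s : e + e ≤ s - t → w ≤ s
    w≤s p = subst (w ≤_) (solve 2 (λ s t → t :+ (s :- t) := s) refl s t) (ℚₚ.+-monoʳ-≤ t p)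
    c : 0ℚ ≤ (t + e) * e
    c = ℚₚ.nonNegative⁻¹ _ {{ℚₚ.nonNeg*nonNeg⇒nonNeg (t + e) {{Rat.nonNegative (0≤+ 0≤t 0≤e)}} e {{Rat.nonNegative 0≤e}}}}
    impossible : e + e ≤ s - t → w * w < w * w
    impossible p = begin-strict
      w * w                             ≤⟨ sq-mono-≤ (0≤+ 0≤t (0≤+ 0≤e 0≤e)) (w≤s p) ⟩
      s * s                             ≤⟨ lower ⟩
      ∣ a ∣                             ≤⟨ ∣p∣≤∣q∣+ a b ⟩
      ∣ b ∣ + ∣ a - b ∣                 <⟨ ℚₚ.+-mono-< upper close ⟩
      (t + h) * (t + h) + e * e         ≤⟨ ℚₚ.+-monoˡ-≤ (e * e) (sq-mono-≤ (0≤+ 0≤t 0≤h) (ℚₚ.+-monoʳ-≤ t h≤e)) ⟩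
      (t + e) * (t + e) + e * e         ≡⟨ ℚₚ.+-identityʳ _ ⟨
      (t + e) * (t + e) + e * e + 0ℚ    ≤⟨ ℚₚ.+-monoʳ-≤ ((t + e) * (t + e) + e * e) (0≤+ c c) ⟩
      (t + e) * (t + e) + e * e + ((t + e) * e + (t + e) * e)
        ≡⟨ solve 2 (λ t e → (t :+ e) :* (t :+ e) :+ e :* e :+ ((t :+ e) :* e :+ (t :+ e) :* e) := (t :+ (e :+ e)) :* (t :+ (e :+ e))) refl t e ⟩
      w * w                             ∎

  ∣p-q∣<⁺ : ∀ {r} p q → p - q < r → q - p < r → ∣ p - q ∣ < r
  ∣p-q∣<⁺ {r} p q p-q<r q-p<r with ℚₚ.∣p∣≡p∨∣p∣≡-p (p - q)
  ... | inj₁ eq = subst (_< r) (sym eq) p-q<r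
  ... | inj₂ eq = subst (_< r) (sym (trans eq (solve 2 (λ s t → :- (s :- t) := t :- s) refl p q))) q-p<r

  0≤1/ : ∀ n → 0ℚ ≤ + 1 / suc n
  0≤1/ n = ℚₚ.nonNegative⁻¹ (+ 1 / suc n) {{ℚₚ.normalize-nonNeg 1 (suc n)}}

  sqrt-close : ∀ {e} → 0ℚ < e → ∀ m n a b → + 1 / suc m ≤ e → + 1 / suc n ≤ e → ∣ a - b ∣ < e * e →
               ∣ sqrtApprox m a - sqrtApprox n b ∣ < e + e
  sqrt-close {e} 0<e m n a b hm hn close = ∣p-q∣<⁺ (sqrtApprox m a) (sqrtApprox n b)
    (root-close 0<e (sqrtApprox m a) (sqrtApprox n b) (+ 1 / suc n) a b (sqrtApprox-nonNeg n b) (0≤1/ n) hn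
      (sqrtApprox-lower m a) (sqrtApprox-upper n b) close)
    (root-close 0<e (sqrtApprox n b) (sqrtApprox m a) (+ 1 / suc m) b a (sqrtApprox-nonNeg m a) (0≤1/ m) hm
      (sqrtApprox-lower n b) (sqrtApprox-upper m a) (subst (_< e * e) (∣p-q∣≡∣q-p∣ a b) close))

  sq-pos : ∀ {e} → 0ℚ < e → 0ℚ < e * e
  sq-pos {e} 0<e = ℚₚ.positive⁻¹ (e * e) {{ℚₚ.pos*pos⇒pos e {{Rat.positive 0<e}} e {{Rat.positive 0<e}}}}

IsCauchy : (ℕ → ℚ) → Set
IsCauchy x = ∀ {ε} → 0ℚ < ε → ∃ λ N → ∀ m n → N ℕ.≤ m → N ℕ.≤ n → ∣ x m - x n ∣ < ε

-- Cantor's construction of ℝ, with _≈ℝ_ in place of the quotient.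
record ℝ : Set where
  constructor mkℝ
  field
    seq    : ℕ → ℚ
    cauchy : IsCauchy seq

open ℝ public

infix 4 _≈ℝ_
_≈ℝ_ : ℝ → ℝ → Set
x ≈ℝ y = ∀ {ε} → 0ℚ < ε → ∃ λ N → ∀ n → N ℕ.≤ n → ∣ seq x n - seq y n ∣ < ε

private
  ⊔-left : ∀ {m n o} → m ℕ.⊔ n ℕ.≤ o → m ℕ.≤ o
  ⊔-left {m} {n} = ℕₚ.m⊔n≤o⇒m≤o m n

  ⊔-right : ∀ {m n o} → m ℕ.⊔ n ℕ.≤ o → n ℕ.≤ o
  ⊔-right {m} {n} = ℕₚ.m⊔n≤o⇒n≤o m n

≈ℝ-refl : ∀ {x} → x ≈ℝ x
≈ℝ-refl {x} {ε} 0<ε = 0 , λ n _ → subst (_< ε) (sym (∣p-p∣≡0 (seq x n))) 0<ε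

≈ℝ-sym : ∀ {x y} → x ≈ℝ y → y ≈ℝ x
≈ℝ-sym {x} {y} x≈y {ε} 0<ε with x≈y 0<ε
... | N , close = N , λ n N≤n → subst (_< ε) (∣p-q∣≡∣q-p∣ (seq x n) (seq y n)) (close n N≤n)

≈ℝ-trans : ∀ {x y z} → x ≈ℝ y → y ≈ℝ z → x ≈ℝ z
≈ℝ-trans {x} {y} {z} x≈y y≈z {ε} 0<ε with x≈y (half-pos 0<ε) | y≈z (half-pos 0<ε)
... | N , f | M , g = N ℕ.⊔ M , λ n le → ℚₚ.≤-<-trans (∣p-r∣≤ (seq x n) (seq y n) (seq z n))
  (subst (∣ seq x n - seq y n ∣ + ∣ seq y n - seq z n ∣ <_) (half+half ε)
    (ℚₚ.+-mono-< (f n (⊔-left le)) (g n (⊔-right le))))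

ℝ-setoid : Setoid 0ℓ 0ℓ
ℝ-setoid = record
  { Carrier       = ℝ
  ; _≈_           = _≈ℝ_
  ; isEquivalence = record
    { refl  = λ {x} → ≈ℝ-refl {x}
    ; sym   = λ {x} {y} → ≈ℝ-sym {x} {y}
    ; trans = λ {x} {y} {z} → ≈ℝ-trans {x} {y} {z}
    }
  }

fromℚ : ℚ → ℝ
fromℚ q = mkℝ (λ _ → q) λ {ε} 0<ε → 0 , λ _ _ _ _ → subst (_< ε) (sym (∣p-p∣≡0 q)) 0<ε

0ℝ 1ℝ : ℝ
0ℝ = fromℚ 0ℚ
1ℝ = fromℚ 1ℚ

infixl 6 _+ℝ_ _-ℝ_
infixl 7 _*ℝ_
infix  8 -ℝ_

_+ℝ_ : ℝ → ℝ → ℝ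
x +ℝ y = mkℝ (λ n → seq x n + seq y n) isCauchy
  where
  isCauchy : IsCauchy (λ n → seq x n + seq y n)
  isCauchy 0<ε with cauchy x (half-pos 0<ε) | cauchy y (half-pos 0<ε)
  ... | N , f | M , g = N ℕ.⊔ M , λ m n p q → +-close (seq x m) (seq y m) (seq x n) (seq y n)
    (f m n (⊔-left p) (⊔-left q)) (g m n (⊔-right p) (⊔-right q))

-ℝ_ : ℝ → ℝ
-ℝ x = mkℝ (λ n → - seq x n) isCauchy
  where
  isCauchy : IsCauchy (λ n → - seq x n)
  isCauchy 0<ε with cauchy x 0<ε
  ... | N , f = N , λ m n p q → neg-close (seq x m) (seq x n) (f m n p q)

_-ℝ_ : ℝ → ℝ → ℝ
x -ℝ y = x +ℝ (-ℝ y)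

private
  0<1 : 0ℚ < 1ℚ
  0<1 = ℚₚ.positive⁻¹ 1ℚ

  bounded : ∀ x → ∃ λ A → 0ℚ ≤ A × ∃ λ N → ∀ n → N ℕ.≤ n → ∣ seq x n ∣ ≤ A
  bounded x with cauchy x 0<1
  ... | N , f = ∣ seq x N ∣ + 1ℚ , 0≤+ (ℚₚ.0≤∣p∣ (seq x N)) (ℚₚ.<⇒≤ 0<1) , N , λ n N≤n →
    ℚₚ.≤-trans (∣p∣≤∣q∣+ (seq x n) (seq x N)) (ℚₚ.+-monoʳ-≤ ∣ seq x N ∣ (ℚₚ.<⇒≤ (f n N N≤n ℕₚ.≤-refl)))

  p≤p+q : ∀ p {q} → 0ℚ ≤ q → p ≤ p + q
  p≤p+q p {q} 0≤q = subst (_≤ p + q) (ℚₚ.+-identityʳ p) (ℚₚ.+-monoʳ-≤ p 0≤q)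

  q≤p+q : ∀ {p} q → 0ℚ ≤ p → q ≤ p + q
  q≤p+q {p} q 0≤p = subst (_≤ p + q) (ℚₚ.+-identityˡ q) (ℚₚ.+-monoˡ-≤ q 0≤p)

  0<p+1 : ∀ {p} → 0ℚ ≤ p → 0ℚ < p + 1ℚ
  0<p+1 {p} 0≤p = ℚₚ.<-≤-trans 0<1 (q≤p+q 1ℚ 0≤p)

  combine : ∀ x y {A C} → 0ℚ ≤ A → 0ℚ ≤ C → ∀ N M →
            (∀ n → N ℕ.≤ n → ∣ seq x n ∣ ≤ A) → (∀ n → M ℕ.≤ n → ∣ seq y n ∣ ≤ C) →
            ∃ λ D → 0ℚ < D × ∃ λ K → ∀ n → K ℕ.≤ n → ∣ seq x n ∣ ≤ D × ∣ seq y n ∣ ≤ D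
  combine x y {A} {C} 0≤A 0≤C N M f g = (A + C) + 1ℚ , 0<p+1 (0≤+ 0≤A 0≤C) , N ℕ.⊔ M , λ n le →
    ℚₚ.≤-trans (f n (⊔-left le)) (ℚₚ.≤-trans (p≤p+q A 0≤C) A+C≤) ,
    ℚₚ.≤-trans (g n (⊔-right le)) (ℚₚ.≤-trans (q≤p+q C 0≤A) A+C≤)
    where
    A+C≤ : A + C ≤ (A + C) + 1ℚ
    A+C≤ = p≤p+q (A + C) (ℚₚ.<⇒≤ 0<1)

  commonBound : ∀ x y → ∃ λ A → 0ℚ < A × ∃ λ N → ∀ n → N ℕ.≤ n → ∣ seq x n ∣ ≤ A × ∣ seq y n ∣ ≤ A
  commonBound x y =
    let (_ , 0≤A , N , f) = bounded x
        (_ , 0≤C , M , g) = bounded y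
    in combine x y 0≤A 0≤C N M f g

_*ℝ_ : ℝ → ℝ → ℝ
x *ℝ y = mkℝ (λ n → seq x n * seq y n) isCauchy
  where
  isCauchy : IsCauchy (λ n → seq x n * seq y n)
  isCauchy 0<ε =
    let (A , 0<A , K , b) = commonBound x y
        (δ , 0<δ , eq)    = *-tolerance 0<A 0<ε
        (N , f)           = cauchy x 0<δ
        (M , g)           = cauchy y 0<δ
    in K ℕ.⊔ (N ℕ.⊔ M) , λ m n p q →
      subst (∣ seq x m * seq y m - seq x n * seq y n ∣ <_) eq
        (*-close 0<A (seq x m) (seq y m) (seq x n) (seq y n)
          (proj₁ (b m (⊔-left p))) (proj₂ (b n (⊔-left q)))
          (f m n (⊔-left (⊔-right {K} p)) (⊔-left (⊔-right {K} q)))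
          (g m n (⊔-right {N} (⊔-right {K} p)) (⊔-right {N} (⊔-right {K} q))))

-- The square root of the absolute value of x, so that it is total;
-- it is only applied to sums of squares below.
√_ : ℝ → ℝ
√ x = mkℝ (λ n → sqrtApprox n (seq x n)) isCauchy
  where
  isCauchy : IsCauchy (λ n → sqrtApprox n (seq x n))
  isCauchy {ε} 0<ε =
    let (N , small) = 1/n-small (half-pos 0<ε)
        (M , f)     = cauchy x (sq-pos (half-pos 0<ε))
    in N ℕ.⊔ M , λ m n p q →
      subst (∣ sqrtApprox m (seq x m) - sqrtApprox n (seq x n) ∣ <_) (half+half ε)
        (sqrt-close (half-pos 0<ε) m n (seq x m) (seq x n)
          (small m (⊔-left p)) (small n (⊔-left q)) (f m n (⊔-right p) (⊔-right q)))

+ℝ-cong : ∀ {x x′ y y′} → x ≈ℝ x′ → y ≈ℝ y′ → x +ℝ y ≈ℝ x′ +ℝ y′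
+ℝ-cong {x} {x′} {y} {y′} x≈ y≈ 0<ε with x≈ (half-pos 0<ε) | y≈ (half-pos 0<ε)
... | N , f | M , g = N ℕ.⊔ M , λ n le → +-close (seq x n) (seq y n) (seq x′ n) (seq y′ n)
  (f n (⊔-left le)) (g n (⊔-right le))

-ℝ-cong : ∀ {x x′} → x ≈ℝ x′ → -ℝ x ≈ℝ -ℝ x′
-ℝ-cong {x} {x′} x≈ 0<ε with x≈ 0<ε
... | N , f = N , λ n le → neg-close (seq x n) (seq x′ n) (f n le)

*ℝ-cong : ∀ {x x′ y y′} → x ≈ℝ x′ → y ≈ℝ y′ → x *ℝ y ≈ℝ x′ *ℝ y′
*ℝ-cong {x} {x′} {y} {y′} x≈ y≈ 0<ε =
  let (A , 0<A , K , b) = commonBound x y′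
      (δ , 0<δ , eq)    = *-tolerance 0<A 0<ε
      (N , f)           = x≈ 0<δ
      (M , g)           = y≈ 0<δ
  in K ℕ.⊔ (N ℕ.⊔ M) , λ n p →
    subst (∣ seq x n * seq y n - seq x′ n * seq y′ n ∣ <_) eq
      (*-close 0<A (seq x n) (seq y n) (seq x′ n) (seq y′ n)
        (proj₁ (b n (⊔-left p))) (proj₂ (b n (⊔-left p)))
        (f n (⊔-left (⊔-right {K} p))) (g n (⊔-right {N} (⊔-right {K} p))))

√-cong : ∀ {x x′} → x ≈ℝ x′ → √ x ≈ℝ √ x′
√-cong {x} {x′} x≈ {ε} 0<ε =
  let (N , small) = 1/n-small (half-pos 0<ε)
      (M , f)     = x≈ (sq-pos (half-pos 0<ε))
  in N ℕ.⊔ M , λ n p →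
    subst (∣ sqrtApprox n (seq x n) - sqrtApprox n (seq x′ n) ∣ <_) (half+half ε)
      (sqrt-close (half-pos 0<ε) n n (seq x n) (seq x′ n)
        (small n (⊔-left p)) (small n (⊔-left p)) (f n (⊔-right p)))

record DistanceSpace : Set₁ where
  field
    points : Setoid 0ℓ 0ℓ
  open Setoid points public
  field
    dist      : Carrier → Carrier → ℝ
    dist-cong : ∀ {x x′ y y′} → x ≈ x′ → y ≈ y′ → dist x y ≈ℝ dist x′ y′

module _ (X : DistanceSpace) where
  private
    module X = DistanceSpace X

  record Isometry : Set where
    field
      bijection : Inverse X.points X.points
    open Inverse bijection public
    field
      isometric : ∀ x y → X.dist (to x) (to y) ≈ℝ X.dist x y

  open Isometry

  Isom : Group 0ℓ 0ℓ
  Isom = record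
    { Carrier = Isometry
    ; _≈_     = λ f g → ∀ x → to f x X.≈ to g x
    ; _∙_     = λ f g → record
      { bijection = Compose.inverse (bijection g) (bijection f)
      ; isometric = λ x y → ≈ℝ-trans {X.dist (to f (to g x)) (to f (to g y))} {X.dist (to g x) (to g y)} {X.dist x y}
                              (isometric f (to g x) (to g y)) (isometric g x y)
      }
    ; ε       = record
      { bijection = Identity.inverse X.points
      ; isometric = λ x y → ≈ℝ-refl {X.dist x y}
      }
    ; _⁻¹     = λ f → record
      { bijection = Symmetry.inverse (bijection f)
      ; isometric = λ x y → ≈ℝ-trans {X.dist (from f x) (from f y)} {X.dist (to f (from f x)) (to f (from f y))} {X.dist x y}
          (≈ℝ-sym {X.dist (to f (from f x)) (to f (from f y))} {X.dist (from f x) (from f y)} (isometric f (from f x) (from f y)))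
          (X.dist-cong (strictlyInverseˡ f x) (strictlyInverseˡ f y))
      }
    ; isGroup = record
      { isMonoid = record
        { isSemigroup = record
          { isMagma = record
            { isEquivalence = record
              { refl  = λ x → X.refl
              ; sym   = λ p x → X.sym (p x)
              ; trans = λ p q x → X.trans (p x) (q x)
              }
            ; ∙-cong = λ {f} {_} {_} {k} p q x → X.trans (to-cong f (q x)) (p (to k x))
            }
          ; assoc = λ f g h x → X.refl
          }
        ; identity = (λ f x → X.refl) , (λ f x → X.refl)
        }
      ; inverse = (λ f x → strictlyInverseʳ f x) , (λ f x → strictlyInverseˡ f x)
      ; ⁻¹-cong = λ {f} {g} p x → inverseʳ f
          (X.sym (X.trans (p (from g x)) (strictlyInverseˡ g x)))
      }
    }

  isomAction : FaithfulAction Isom X.points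
  isomAction = record
    { _·_      = to
    ; ·-cong   = λ {f} {g} {x} {y} p q → X.trans (to-cong f q) (p y)
    ; ε-·      = λ x → X.refl
    ; ∙-·      = λ f g x → X.refl
    ; faithful = λ f p → p
    }

∑ : ∀ {n} → Vector ℝ n → ℝ
∑ = foldr _+ℝ_ 0ℝ

‖_‖ : ∀ {n} → Vector ℝ n → ℝ
‖ x ‖ = √ ∑ (map (λ t → t *ℝ t) x)

∑-cong : ∀ {n} {x y : Vector ℝ n} → (∀ i → x i ≈ℝ y i) → ∑ x ≈ℝ ∑ y
∑-cong {zero}          p = ≈ℝ-refl {0ℝ}
∑-cong {suc n} {x} {y} p = +ℝ-cong {x Fin.zero} {y Fin.zero} {∑ (x ∘ Fin.suc)} {∑ (y ∘ Fin.suc)}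
  (p Fin.zero) (∑-cong {n} {x ∘ Fin.suc} {y ∘ Fin.suc} (p ∘ Fin.suc))

‖‖-cong : ∀ {n} {x y : Vector ℝ n} → (∀ i → x i ≈ℝ y i) → ‖ x ‖ ≈ℝ ‖ y ‖
‖‖-cong {n} {x} {y} p = √-cong {∑ (map sq x)} {∑ (map sq y)}
  (∑-cong {n} {map sq x} {map sq y} (λ i → *ℝ-cong {x i} {y i} {x i} {y i} (p i) (p i)))
  where
  sq : ℝ → ℝ
  sq t = t *ℝ t

Euclidean : ℕ → DistanceSpace
Euclidean n = record
  { points    = record
    { Carrier       = Vector ℝ n
    ; _≈_           = λ x y → ∀ i → x i ≈ℝ y i
    ; isEquivalence = record
      { refl  = λ {x} i → ≈ℝ-refl {x i}
      ; sym   = λ {x} {y} p i → ≈ℝ-sym {x i} {y i} (p i)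
      ; trans = λ {x} {y} {z} p q i → ≈ℝ-trans {x i} {y i} {z i} (p i) (q i)
      }
    }
  ; dist      = λ x y → ‖ zipWith _-ℝ_ x y ‖
  ; dist-cong = λ {x} {x′} {y} {y′} p q → ‖‖-cong {n} {zipWith _-ℝ_ x y} {zipWith _-ℝ_ x′ y′}
      (λ i → +ℝ-cong {x i} {x′ i} { -ℝ y i} { -ℝ y′ i} (p i) (-ℝ-cong {y i} {y′ i} (q i)))
  }

-- The unit sphere in ℝⁿ⁺¹ with the distance induced from ℝⁿ⁺¹.  The
-- angular distance θ satisfies chord = 2 sin(θ/2), which is injective on
-- [0,π], so both distances have the same isometries.
Sphere : ℕ → DistanceSpace
Sphere n = record
  { points    = On.setoid E.points (proj₁ {B = λ x → ‖ x ‖ ≈ℝ 1ℝ})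
  ; dist      = λ x y → E.dist (proj₁ x) (proj₁ y)
  ; dist-cong = λ {x} {x′} {y} {y′} p q → E.dist-cong {proj₁ x} {proj₁ x′} {proj₁ y} {proj₁ y′} p q
  }
  where module E = DistanceSpace (Euclidean (suc n))

{-# OPTIONS --safe #-}
module Submission where

-- Let L be the subspace x₀ = x₁ = 0, put W = L ∪ {e₀, e₁} (intersected with
-- the sphere in the spherical case), and color the complement of W red.  In
-- an extension the blue points lie in W.  If e₀ and e₁ have the same color,
-- exchanging the first two coordinates preserves the coloring; otherwise one
-- of them, eᵢ, is red and the reflection xᵢ ↦ -xᵢ fixes every blue point.
-- An isometry fixing every eᵢ, and the origin when X = ℝⁿ, is the identity
-- because coordinates are determined by distances (polarization).  Finally L
-- contains a Cantor set, on which digits can be read off from approximations,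
-- so that Cantor's diagonal argument applies constructively.

open import Defs
open import Data.Bool.Base using (Bool; true; false; not; T)
open import Data.Bool.Properties using (not-¬)
open import Data.Empty using (⊥)
open import Data.Fin.Base using (Fin; zero; suc; toℕ)
open import Data.Fin.Properties using (toℕ-injective)
import Data.Integer.Base as ℤ
import Data.Integer.Properties as ℤₚ
open import Data.Nat.Base using (ℕ; _≤_; s≤s; _⊔_; _∸_; _≡ᵇ_)
import Data.Nat.Base as ℕ
import Data.Nat.Properties as ℕₚ
open import Data.Product using (∃; _×_; _,_; proj₁; proj₂)
open import Data.Rational.Base using (ℚ; mkℚ; 0ℚ; 1ℚ; ½; _+_; _*_; _-_; -_; ∣_∣; _/_; toℚᵘ) renaming (_≤_ to _≤ℚ_; _<_ to _<ℚ_)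
import Data.Rational.Base as ℚ
import Data.Rational.Properties as ℚₚ
open import Data.Rational.Solver using (module +-*-Solver)
import Data.Rational.Unnormalised.Base as ℚᵘ
import Data.Rational.Unnormalised.Properties as ℚᵘₚ
open import Data.Sum using (_⊎_; inj₁; inj₂)
open import Data.Vec.Functional using (Vector; foldr; map; zipWith; updateAt; _∷_)
open import Function.Base using (_∘_)
open import Function.Bundles using (Func; Surjection)
open import Relation.Binary.PropositionalEquality using (_≡_; refl; sym; trans; cong; cong₂; subst; subst₂)
open import Relation.Nullary using (Dec; ¬_; yes; no; does; contradiction)
open import Relation.Nullary.Construct.Add.Supremum using (⊤⁺)
open import Relation.Nullary.Decidable using (dec-true; dec-false; decidable-stable; from-yes)

open +-*-Solver using (solve; _:+_; _:*_; _:-_; :-_; _:=_; con)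

-- Inequalities between rational numbers.

¼ : ℚ
¼ = ℤ.+ 1 / 4

p≤∣p∣ : ∀ p → p ≤ℚ ∣ p ∣
p≤∣p∣ p with ℚₚ.≤-total 0ℚ p
... | inj₁ 0≤p = ℚₚ.≤-reflexive (sym (ℚₚ.0≤p⇒∣p∣≡p 0≤p))
... | inj₂ p≤0 = ℚₚ.≤-trans p≤0 (ℚₚ.0≤∣p∣ p)

∣p-q∣≡∣q-p∣ : ∀ p q → ∣ p - q ∣ ≡ ∣ q - p ∣
∣p-q∣≡∣q-p∣ p q = trans (cong ∣_∣ (solve 2 (λ p q → p :- q := :- (q :- p)) refl p q)) (ℚₚ.∣-p∣≡∣p∣ (q - p))

∣p-q∣<r⇒p<q+r : ∀ p q {r} → ∣ p - q ∣ <ℚ r → p <ℚ q + r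
∣p-q∣<r⇒p<q+r p q {r} p-q<r = subst (_<ℚ q + r)
  (solve 2 (λ p q → q :+ (p :- q) := p) refl p q)
  (ℚₚ.+-monoʳ-< q (ℚₚ.≤-<-trans (p≤∣p∣ (p - q)) p-q<r))

∣p-q∣≤-between : ∀ {p q r} → 0ℚ ≤ℚ p → p ≤ℚ r → 0ℚ ≤ℚ q → q ≤ℚ r → ∣ p - q ∣ ≤ℚ r
∣p-q∣≤-between {p} {q} {r} 0≤p p≤r 0≤q q≤r with ℚₚ.∣p∣≡p∨∣p∣≡-p (p - q)
... | inj₁ eq = subst (_≤ℚ r) (sym eq) (subst (p - q ≤ℚ_) (ℚₚ.+-identityʳ r) (ℚₚ.+-mono-≤ p≤r (ℚₚ.neg-antimono-≤ 0≤q)))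
... | inj₂ eq = subst (_≤ℚ r) (sym (trans eq (solve 2 (λ p q → :- (p :- q) := q :- p) refl p q)))
  (subst (q - p ≤ℚ_) (ℚₚ.+-identityʳ r) (ℚₚ.+-mono-≤ q≤r (ℚₚ.neg-antimono-≤ 0≤p)))

∣p-q∣-monoˡ : ∀ {p q r} → q ≤ℚ p → p ≤ℚ r → ∣ p - q ∣ ≤ℚ ∣ r - q ∣
∣p-q∣-monoˡ {p} {q} {r} q≤p p≤r = begin
  ∣ p - q ∣  ≡⟨ ℚₚ.0≤p⇒∣p∣≡p (subst (_≤ℚ p - q) (ℚₚ.+-inverseʳ q) (ℚₚ.+-monoˡ-≤ (- q) q≤p)) ⟩
  p - q      ≤⟨ ℚₚ.+-monoˡ-≤ (- q) p≤r ⟩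
  r - q      ≤⟨ p≤∣p∣ (r - q) ⟩
  ∣ r - q ∣  ∎
  where open ℚₚ.≤-Reasoning

p*p≤q*q⇒p≤q : ∀ {p q} → 0ℚ ≤ℚ q → p * p ≤ℚ q * q → p ≤ℚ q
p*p≤q*q⇒p≤q {p} {q} 0≤q p²≤q² = ℚₚ.≮⇒≥ λ q<p → ℚₚ.<-irrefl refl (ℚₚ.<-≤-trans (q²<p² q<p) p²≤q²)
  where
  q²<p² : q <ℚ p → q * q <ℚ p * p
  q²<p² q<p = ℚₚ.≤-<-trans (ℚₚ.*-monoˡ-≤-nonNeg q {{ℚ.nonNegative 0≤q}} (ℚₚ.<⇒≤ q<p))
    (ℚₚ.*-monoˡ-<-pos p {{ℚ.positive (ℚₚ.≤-<-trans 0≤q q<p)}} q<p)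

-- This is the gap between the two estimates `sqrtApprox-lower` and `sqrtApprox-upper`, and it also
-- serves below as a modulus of convergence.
harmonic : ℕ → ℚ
harmonic n = ℤ.+ 1 / ℕ.suc n

toℚᵘ-harmonic : ∀ n → toℚᵘ (harmonic n) ℚᵘ.≃ ℚᵘ.mkℚᵘ (ℤ.+ 1) n
toℚᵘ-harmonic n = ℚₚ.toℚᵘ-fromℚᵘ (ℚᵘ.mkℚᵘ (ℤ.+ 1) n)

harmonic-nonNeg : ∀ n → 0ℚ ≤ℚ harmonic n
harmonic-nonNeg n = ℚₚ.nonNegative⁻¹ (harmonic n) {{ℚₚ.normalize-nonNeg 1 (ℕ.suc n)}}

harmonic-small : ∀ {ε} → 0ℚ <ℚ ε → ∃ λ N → ∀ n → N ≤ n → harmonic n <ℚ ε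
harmonic-small {mkℚ (ℤ.+ ℕ.zero) d c} (ℚ.*<* (ℤ.+<+ ()))
harmonic-small {mkℚ ℤ.-[1+ _ ] d c} (ℚ.*<* ())
harmonic-small {mkℚ (ℤ.+ ℕ.suc p) d c} _ = ℕ.suc d , λ n d<n → ℚₚ.toℚᵘ-cancel-<
  (ℚᵘₚ.<-respˡ-≃ (ℚᵘₚ.≃-sym (toℚᵘ-harmonic n)) (ℚᵘ.*<* (subst₂ ℤ._<_ (ℤₚ.pos-* 1 (ℕ.suc d)) (ℤₚ.pos-* (ℕ.suc p) (ℕ.suc n))
    (ℤ.+<+ (ℕₚ.<-≤-trans (s≤s (subst (_≤ n) (sym (ℕₚ.+-identityʳ (ℕ.suc d))) d<n)) (ℕₚ.m≤n*m (ℕ.suc n) (ℕ.suc p)))))))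

-- Lets `harmonic` bound a series that converges geometrically: one contraction by ¼ outweighs the
-- passage from 1/(n+1) to 1/(n+2).
¼*harmonic≤harmonic : ∀ n → ¼ * harmonic n ≤ℚ harmonic (ℕ.suc n)
¼*harmonic≤harmonic n = ℚₚ.toℚᵘ-cancel-≤
  (ℚᵘₚ.≤-respˡ-≃ (ℚᵘₚ.≃-sym (ℚᵘₚ.≃-trans (ℚₚ.toℚᵘ-homo-* ¼ (harmonic n)) (ℚᵘₚ.*-cong (ℚᵘₚ.≃-refl {toℚᵘ ¼}) (toℚᵘ-harmonic n))))
  (ℚᵘₚ.≤-respʳ-≃ (ℚᵘₚ.≃-sym (toℚᵘ-harmonic (ℕ.suc n)))
    (ℚᵘ.*≤* (ℤ.+≤+ (ℕₚ.≤-trans (ℕₚ.≤-reflexive (ℕₚ.*-identityˡ (ℕ.suc (ℕ.suc n)))) bound)))))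
  where
  bound : ℕ.suc (ℕ.suc n) ≤ 1 ℕ.* (4 ℕ.* ℕ.suc n)
  bound = subst (ℕ.suc (ℕ.suc n) ≤_) (sym (ℕₚ.*-identityˡ (4 ℕ.* ℕ.suc n)))
    (ℕₚ.≤-trans (s≤s (ℕₚ.m≤n+m (ℕ.suc n) n)) (ℕₚ.+-monoʳ-≤ (ℕ.suc n) (ℕₚ.m≤m+n (ℕ.suc n) _)))

-- Equality of Cauchy reals and square roots.

0<1 : 0ℚ <ℚ 1ℚ
0<1 = from-yes (0ℚ ℚₚ.<? 1ℚ)

-- The ring operations on reals act term by term, so this turns polynomial identities over ℚ, which
-- the solver proves, into identities over ℝ.
≡⇒≈ℝ : ∀ x y → (∀ n → seq x n ≡ seq y n) → x ≈ℝ y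
≡⇒≈ℝ x y eq {ε} 0<ε = 0 , λ n _ → subst (_<ℚ ε)
  (sym (trans (cong (λ t → ∣ t - seq y n ∣) (eq n)) (cong ∣_∣ (ℚₚ.+-inverseʳ (seq y n))))) 0<ε

fromℚ-separated : ∀ {p q} → fromℚ p ≈ℝ fromℚ q → ¬ 1ℚ ≤ℚ ∣ p - q ∣
fromℚ-separated p≈q 1≤ = let (N , close) = p≈q 0<1 in ℚₚ.<-irrefl refl (ℚₚ.<-≤-trans (close N ℕₚ.≤-refl) 1≤)

-1≉1 : ¬ (-ℝ 1ℝ) ≈ℝ 1ℝ
-1≉1 p = fromℚ-separated { - 1ℚ} {1ℚ} p (from-yes (1ℚ ℚₚ.≤? ∣ - 1ℚ - 1ℚ ∣))

0≉1 : ¬ 0ℝ ≈ℝ 1ℝ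
0≉1 p = fromℚ-separated {0ℚ} {1ℚ} p (from-yes (1ℚ ℚₚ.≤? ∣ 0ℚ - 1ℚ ∣))

-- A representative of 0 whose terms are the errors of `sqrtApprox`. Having it as a real number lets
-- the congruence lemmas for sums and products do the ε-estimates.
harmonicℝ : ℝ
harmonicℝ = mkℝ harmonic λ 0<ε → let (N , small) = harmonic-small 0<ε in N , λ m n N≤m N≤n →
  ℚₚ.≤-<-trans (∣p-q∣≤-between (harmonic-nonNeg m) (ℚₚ.p≤p⊔q (harmonic m) (harmonic n)) (harmonic-nonNeg n) (ℚₚ.p≤q⊔p (harmonic m) (harmonic n)))
    (⊔-< (small m N≤m) (small n N≤n))
  where
  ⊔-< : ∀ {p q r} → p <ℚ r → q <ℚ r → p ℚ.⊔ q <ℚ r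
  ⊔-< {p} {q} {r} p<r q<r with ℚₚ.⊔-sel p q
  ... | inj₁ eq = subst (_<ℚ r) (sym eq) p<r
  ... | inj₂ eq = subst (_<ℚ r) (sym eq) q<r

harmonicℝ≈0 : harmonicℝ ≈ℝ 0ℝ
harmonicℝ≈0 {ε} 0<ε = let (N , small) = harmonic-small 0<ε in N , λ n N≤n →
  ℚₚ.≤-<-trans (∣p-q∣≤-between (harmonic-nonNeg n) ℚₚ.≤-refl ℚₚ.≤-refl (harmonic-nonNeg n)) (small n N≤n)

-- Asked of every term, which is stronger than nonnegativity of the limit. It allows the absolute
-- value inside `√` to be dropped term by term.
NonNegative : ℝ → Set
NonNegative x = ∀ n → 0ℚ ≤ℚ seq x n

-- With s the approximate root of the term q and h the harmonic error, s² ≤ q < (s + h)². Adding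
-- `harmonicℝ` does not change the real number `√ x`, so both ends of this interval represent the
-- same real and q is squeezed between them.
√²≈ : ∀ x → NonNegative x → (√ x) *ℝ (√ x) ≈ℝ x
√²≈ x 0≤x {ε} 0<ε = let (N , close) = [s+h]²≈s² 0<ε in N , λ n N≤n →
  let q = seq x n
      s = sqrtApprox n q
      ∣q∣≡q = ℚₚ.0≤p⇒∣p∣≡p (0≤x n)
  in ℚₚ.≤-<-trans (ℚₚ.≤-trans (ℚₚ.≤-reflexive (∣p-q∣≡∣q-p∣ (s * s) q))
       (∣p-q∣-monoˡ (subst (s * s ≤ℚ_) ∣q∣≡q (sqrtApprox-lower n q))
         (subst (_≤ℚ (s + harmonic n) * (s + harmonic n)) ∣q∣≡q (ℚₚ.<⇒≤ (sqrtApprox-upper n q)))))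
     (close n N≤n)
  where
  s+h : ℝ
  s+h = √ x +ℝ harmonicℝ
  s+h≈s : s+h ≈ℝ √ x
  s+h≈s = ≈ℝ-trans {s+h} {√ x +ℝ 0ℝ} {√ x}
    (+ℝ-cong {√ x} {√ x} {harmonicℝ} {0ℝ} (≈ℝ-refl {√ x}) harmonicℝ≈0)
    (≡⇒≈ℝ (√ x +ℝ 0ℝ) (√ x) (λ n → ℚₚ.+-identityʳ (seq (√ x) n)))
  [s+h]²≈s² : s+h *ℝ s+h ≈ℝ (√ x) *ℝ (√ x)
  [s+h]²≈s² = *ℝ-cong {s+h} {√ x} {s+h} {√ x} s+h≈s s+h≈s

√-injective : ∀ x y → NonNegative x → NonNegative y → √ x ≈ℝ √ y → x ≈ℝ y
√-injective x y 0≤x 0≤y √x≈√y =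
  ≈ℝ-trans {x} {(√ x) *ℝ (√ x)} {y} (≈ℝ-sym {(√ x) *ℝ (√ x)} {x} (√²≈ x 0≤x))
    (≈ℝ-trans {(√ x) *ℝ (√ x)} {(√ y) *ℝ (√ y)} {y}
      (*ℝ-cong {√ x} {√ y} {√ x} {√ y} √x≈√y √x≈√y) (√²≈ y 0≤y))

√1≈1 : √ 1ℝ ≈ℝ 1ℝ
√1≈1 {ε} 0<ε = let (N , small) = harmonic-small 0<ε in N , λ n N≤n → ℚₚ.≤-<-trans (bound n) (small n N≤n)
  where
  open ℚₚ.≤-Reasoning
  bound : ∀ n → ∣ sqrtApprox n 1ℚ - 1ℚ ∣ ≤ℚ harmonic n
  bound n = begin
    ∣ s - 1ℚ ∣                  ≡⟨ ∣p-q∣≡∣q-p∣ s 1ℚ ⟩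
    ∣ 1ℚ - s ∣                  ≤⟨ ∣p-q∣-monoˡ s≤1 1≤s+h ⟩
    ∣ (s + harmonic n) - s ∣    ≡⟨ cong ∣_∣ (solve 2 (λ s h → (s :+ h) :- s := h) refl s (harmonic n)) ⟩
    ∣ harmonic n ∣              ≡⟨ ℚₚ.0≤p⇒∣p∣≡p (harmonic-nonNeg n) ⟩
    harmonic n                  ∎
    where
    s = sqrtApprox n 1ℚ
    s≤1 : s ≤ℚ 1ℚ
    s≤1 = p*p≤q*q⇒p≤q (ℚₚ.<⇒≤ 0<1) (sqrtApprox-lower n 1ℚ)
    1≤s+h : 1ℚ ≤ℚ s + harmonic n
    1≤s+h = p*p≤q*q⇒p≤q (ℚₚ.+-mono-≤ (sqrtApprox-nonNeg n 1ℚ) (harmonic-nonNeg n)) (ℚₚ.<⇒≤ (sqrtApprox-upper n 1ℚ))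

-- A Cantor set in base 4 and the recovery of its digits.

bit : Bool → ℚ
bit false = 0ℚ
bit true  = 1ℚ

-- Partial sums of ∑ α(k)/4ᵏ⁺¹.
cantorSum : ℕ → (ℕ → Bool) → ℚ
cantorSum ℕ.zero    α = 0ℚ
cantorSum (ℕ.suc n) α = ¼ * (bit (α 0) + cantorSum n (α ∘ ℕ.suc))

0≤bit : ∀ b → 0ℚ ≤ℚ bit b
0≤bit false = ℚₚ.≤-refl
0≤bit true  = ℚₚ.<⇒≤ 0<1

bit≤1 : ∀ b → bit b ≤ℚ 1ℚ
bit≤1 false = ℚₚ.<⇒≤ 0<1
bit≤1 true  = ℚₚ.≤-refl

0≤cantorSum : ∀ n α → 0ℚ ≤ℚ cantorSum n α
0≤cantorSum ℕ.zero    α = ℚₚ.≤-refl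
0≤cantorSum (ℕ.suc n) α = ℚₚ.*-monoˡ-≤-nonNeg ¼ (ℚₚ.+-mono-≤ (0≤bit (α 0)) (0≤cantorSum n (α ∘ ℕ.suc)))

-- The largest possible sum is 1/3; ½ is a convenient bound that survives the step s ↦ ¼(b + s),
-- because ¼(1 + ½) ≤ ½.
cantorSum≤½ : ∀ n α → cantorSum n α ≤ℚ ½
cantorSum≤½ ℕ.zero    α = from-yes (0ℚ ℚₚ.≤? ½)
cantorSum≤½ (ℕ.suc n) α = ℚₚ.≤-trans
  (ℚₚ.*-monoˡ-≤-nonNeg ¼ (ℚₚ.+-mono-≤ (bit≤1 (α 0)) (cantorSum≤½ n (α ∘ ℕ.suc))))
  (from-yes (¼ * (1ℚ + ½) ℚₚ.≤? ½))

-- Two partial sums share their first digit, and removing it exposes a factor ¼. At N = 0 both sums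
-- lie in [0, ½] and `harmonic 0` is 1.
cantorSum-close : ∀ N m n α → N ≤ m → N ≤ n → ∣ cantorSum m α - cantorSum n α ∣ ≤ℚ harmonic N
cantorSum-close ℕ.zero m n α _ _ = ℚₚ.≤-trans
  (∣p-q∣≤-between (0≤cantorSum m α) (cantorSum≤½ m α) (0≤cantorSum n α) (cantorSum≤½ n α))
  (from-yes (½ ℚₚ.≤? 1ℚ))
cantorSum-close (ℕ.suc N) (ℕ.suc m) (ℕ.suc n) α (s≤s N≤m) (s≤s N≤n) = begin
  ∣ ¼ * (b + s) - ¼ * (b + t) ∣  ≡⟨ cong ∣_∣ (solve 3 (λ b s t → con ¼ :* (b :+ s) :- con ¼ :* (b :+ t) := con ¼ :* (s :- t)) refl b s t) ⟩
  ∣ ¼ * (s - t) ∣                ≡⟨ ℚₚ.∣p*q∣≡∣p∣*∣q∣ ¼ (s - t) ⟩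
  ¼ * ∣ s - t ∣                  ≤⟨ ℚₚ.*-monoˡ-≤-nonNeg ¼ (cantorSum-close N m n (α ∘ ℕ.suc) N≤m N≤n) ⟩
  ¼ * harmonic N                 ≤⟨ ¼*harmonic≤harmonic N ⟩
  harmonic (ℕ.suc N)             ∎
  where
  open ℚₚ.≤-Reasoning
  b = bit (α 0)
  s = cantorSum m (α ∘ ℕ.suc)
  t = cantorSum n (α ∘ ℕ.suc)

cantor : (ℕ → Bool) → ℝ
cantor α = mkℝ (λ n → cantorSum n α) λ 0<ε → let (N , small) = harmonic-small 0<ε in N , λ m n N≤m N≤n →
  ℚₚ.≤-<-trans (cantorSum-close N m n α N≤m N≤n) (small N ℕₚ.≤-refl)

4ℚ 1/32 3/16 : ℚ
4ℚ = ℤ.+ 4 / 1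
1/32 = ℤ.+ 1 / 32
3/16 = ℤ.+ 3 / 16

0<1/32 : 0ℚ <ℚ 1/32
0<1/32 = from-yes (0ℚ ℚₚ.<? 1/32)

-- cantor α lies in [0, 1/8] or in [1/4, 1/2] according to α 0, and 3/16
-- is the midpoint of the gap, so an approximation within 1/16 suffices.
digit : ℝ → Bool
digit x = does (3/16 ℚₚ.<? seq x (proj₁ (cauchy x 0<1/32)))

dropDigit : Bool → ℝ → ℝ
dropDigit b x = fromℚ 4ℚ *ℝ x -ℝ fromℚ (bit b)

-- Total on ℝ, because an enumeration of `W` may produce points off the Cantor set. There the result
-- may depend on the representing sequence, which is harmless for the diagonal argument.
digits : ℝ → ℕ → Bool
digits x ℕ.zero    = digit x
digits x (ℕ.suc n) = digits (dropDigit (digit x) x) n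

digit-cantor : ∀ x α → x ≈ℝ cantor α → digit x ≡ α 0
digit-cantor x α x≈α = compare (α 0) refl
  where
  N = proj₁ (cauchy x 0<1/32)
  M = proj₁ (x≈α 0<1/32)
  -- The index `ℕ.suc K` lies past both moduli and, being a successor, makes `t` unfold to
  -- ¼(`bit (α 0)` + `s`).
  K = N ⊔ M
  q = seq x N
  r = seq x (ℕ.suc K)
  t = cantorSum (ℕ.suc K) α
  s = cantorSum K (α ∘ ℕ.suc)
  N≤ : N ≤ ℕ.suc K
  N≤ = ℕₚ.m≤n⇒m≤1+n (ℕₚ.m≤m⊔n N M)
  q-r : ∣ q - r ∣ <ℚ 1/32
  q-r = proj₂ (cauchy x 0<1/32) N (ℕ.suc K) ℕₚ.≤-refl N≤
  r-t : ∣ r - t ∣ <ℚ 1/32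
  r-t = proj₂ (x≈α 0<1/32) (ℕ.suc K) (ℕₚ.m≤n⇒m≤1+n (ℕₚ.m≤n⊔m N M))
  open ℚₚ.≤-Reasoning
  small : α 0 ≡ false → q ≤ℚ 3/16
  small eq = begin
    q                        ≤⟨ ℚₚ.<⇒≤ (∣p-q∣<r⇒p<q+r q r q-r) ⟩
    r + 1/32                 ≤⟨ ℚₚ.+-monoˡ-≤ 1/32 (ℚₚ.<⇒≤ (∣p-q∣<r⇒p<q+r r t r-t)) ⟩
    t + 1/32 + 1/32          ≡⟨ cong (λ b → ¼ * (bit b + s) + 1/32 + 1/32) eq ⟩
    ¼ * (0ℚ + s) + 1/32 + 1/32
      ≤⟨ ℚₚ.+-monoˡ-≤ 1/32 (ℚₚ.+-monoˡ-≤ 1/32 (ℚₚ.*-monoˡ-≤-nonNeg ¼ (ℚₚ.+-monoʳ-≤ 0ℚ (cantorSum≤½ K (α ∘ ℕ.suc))))) ⟩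
    ¼ * (0ℚ + ½) + 1/32 + 1/32  ≡⟨⟩
    3/16                     ∎
  large : α 0 ≡ true → 3/16 <ℚ q
  large eq = ℚₚ.≰⇒> λ q≤3/16 → ℚₚ.<-irrefl refl (begin-strict
    ¼                        ≡⟨⟩
    ¼ * (1ℚ + 0ℚ)            ≤⟨ ℚₚ.*-monoˡ-≤-nonNeg ¼ (ℚₚ.+-monoʳ-≤ 1ℚ (0≤cantorSum K (α ∘ ℕ.suc))) ⟩
    ¼ * (1ℚ + s)             ≡⟨ cong (λ b → ¼ * (bit b + s)) eq ⟨
    t                        <⟨ ∣p-q∣<r⇒p<q+r t r (subst (_<ℚ 1/32) (∣p-q∣≡∣q-p∣ r t) r-t) ⟩
    r + 1/32                 <⟨ ℚₚ.+-monoˡ-< 1/32 (∣p-q∣<r⇒p<q+r r q (subst (_<ℚ 1/32) (∣p-q∣≡∣q-p∣ q r) q-r)) ⟩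
    q + 1/32 + 1/32          ≤⟨ ℚₚ.+-monoˡ-≤ 1/32 (ℚₚ.+-monoˡ-≤ 1/32 q≤3/16) ⟩
    3/16 + 1/32 + 1/32       ≡⟨⟩
    ¼                        ∎)
  compare : ∀ b → α 0 ≡ b → digit x ≡ α 0
  compare false eq = trans (dec-false (3/16 ℚₚ.<? q) (λ lt → ℚₚ.<-irrefl refl (ℚₚ.<-≤-trans lt (small eq)))) (sym eq)
  compare true  eq = trans (dec-true (3/16 ℚₚ.<? q) (large eq)) (sym eq)

dropDigit-cantor : ∀ x α → x ≈ℝ cantor α → dropDigit (α 0) x ≈ℝ cantor (α ∘ ℕ.suc)
dropDigit-cantor x α x≈α = ≈ℝ-trans {dropDigit (α 0) x} {dropDigit (α 0) (cantor α)} {cantor (α ∘ ℕ.suc)}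
  (+ℝ-cong {fromℚ 4ℚ *ℝ x} {fromℚ 4ℚ *ℝ cantor α} { -ℝ fromℚ b} { -ℝ fromℚ b}
    (*ℝ-cong {fromℚ 4ℚ} {fromℚ 4ℚ} {x} {cantor α} (≈ℝ-refl {fromℚ 4ℚ}) x≈α) (≈ℝ-refl { -ℝ fromℚ b}))
  shift
  where
  b = bit (α 0)
  shift : dropDigit (α 0) (cantor α) ≈ℝ cantor (α ∘ ℕ.suc)
  -- Dropping a digit shifts the partial sums by one: term n + 1 on the left equals term n of the
  -- shifted series, so the Cauchy property absorbs the difference. The threshold `ℕ.suc N` excludes
  -- index 0.
  shift {ε} 0<ε = let (N , close) = cauchy (cantor (α ∘ ℕ.suc)) 0<ε in ℕ.suc N , λ where
    (ℕ.suc n) (s≤s N≤n) → subst (λ t → ∣ t - cantorSum (ℕ.suc n) (α ∘ ℕ.suc) ∣ <ℚ ε)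
      (solve 2 (λ s b → s := con 4ℚ :* (con ¼ :* (b :+ s)) :- b) refl (cantorSum n (α ∘ ℕ.suc)) b)
      (close n (ℕ.suc n) N≤n (ℕₚ.m≤n⇒m≤1+n N≤n))

digits-cantor : ∀ n x α → x ≈ℝ cantor α → digits x n ≡ α n
digits-cantor ℕ.zero    x α x≈α = digit-cantor x α x≈α
digits-cantor (ℕ.suc n) x α x≈α = digits-cantor n (dropDigit (digit x) x) (α ∘ ℕ.suc)
  (subst (λ b → dropDigit b x ≈ℝ cantor (α ∘ ℕ.suc)) (sym (digit-cantor x α x≈α)) (dropDigit-cantor x α x≈α))

-- Norms of real vectors and polarization.

infixl 6 _⊖_
_⊖_ : ∀ {n} → Vector ℝ n → Vector ℝ n → Vector ℝ n
_⊖_ = zipWith _-ℝ_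

infix 4 _≋_
_≋_ : ∀ {n} → Vector ℝ n → Vector ℝ n → Set
x ≋ y = ∀ i → x i ≈ℝ y i

∑² : ∀ {n} → Vector ℝ n → ℝ
∑² x = ∑ (map (λ t → t *ℝ t) x)

-- Comparing real sums definitionally would compare Cauchy proofs, so
-- identities between sums of squares are proved on rational vectors.
sumSq : ∀ {n} → Vector ℚ n → ℚ
sumSq u = foldr _+_ 0ℚ (λ i → u i * u i)

seq-∑ : ∀ {n} (x : Vector ℝ n) m → seq (∑ x) m ≡ foldr _+_ 0ℚ (λ i → seq (x i) m)
seq-∑ {ℕ.zero}  x m = refl
seq-∑ {ℕ.suc n} x m = cong (λ s → seq (x zero) m + s) (seq-∑ (x ∘ suc) m)

seq-∑² : ∀ {n} (x : Vector ℝ n) m → seq (∑² x) m ≡ sumSq (λ i → seq (x i) m)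
seq-∑² x = seq-∑ (map (λ t → t *ℝ t) x)

∑²-≈ : ∀ {n} (x y : Vector ℝ n) → (∀ m → sumSq (λ i → seq (x i) m) ≡ sumSq (λ i → seq (y i) m)) → ∑² x ≈ℝ ∑² y
∑²-≈ x y eq = ≡⇒≈ℝ (∑² x) (∑² y) λ m → trans (seq-∑² x m) (trans (eq m) (sym (seq-∑² y m)))

0≤p*p : ∀ p → 0ℚ ≤ℚ p * p
0≤p*p p = subst (0ℚ ≤ℚ_) (∣p∣²≡p² (ℚₚ.∣p∣≡p∨∣p∣≡-p p))
  (ℚₚ.nonNegative⁻¹ _ {{ℚₚ.nonNeg*nonNeg⇒nonNeg (∣ p ∣) {{ℚₚ.∣-∣-nonNeg p}} (∣ p ∣) {{ℚₚ.∣-∣-nonNeg p}}}})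
  where
  ∣p∣²≡p² : ∣ p ∣ ≡ p ⊎ ∣ p ∣ ≡ - p → ∣ p ∣ * ∣ p ∣ ≡ p * p
  ∣p∣²≡p² (inj₁ eq) = cong₂ _*_ eq eq
  ∣p∣²≡p² (inj₂ eq) = trans (cong₂ _*_ eq eq) (solve 1 (λ p → (:- p) :* (:- p) := p :* p) refl p)

0≤sumSq : ∀ {n} (u : Vector ℚ n) → 0ℚ ≤ℚ sumSq u
0≤sumSq {ℕ.zero}  u = ℚₚ.≤-refl
0≤sumSq {ℕ.suc n} u = ℚₚ.+-mono-≤ (0≤p*p (u zero)) (0≤sumSq (u ∘ suc))

∑²-nonNegative : ∀ {n} (x : Vector ℝ n) → NonNegative (∑² x)
∑²-nonNegative x m = subst (0ℚ ≤ℚ_) (sym (seq-∑² x m)) (0≤sumSq (λ i → seq (x i) m))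

∑²-injective : ∀ {n} (x y : Vector ℝ n) → ‖ x ‖ ≈ℝ ‖ y ‖ → ∑² x ≈ℝ ∑² y
∑²-injective x y = √-injective (∑² x) (∑² y) (∑²-nonNegative x) (∑²-nonNegative y)

sumSq-cong : ∀ {n} {u v : Vector ℚ n} → (∀ i → u i ≡ v i) → sumSq u ≡ sumSq v
sumSq-cong {ℕ.zero}  eq = refl
sumSq-cong {ℕ.suc n} eq = cong₂ (λ p s → p * p + s) (eq zero) (sumSq-cong (eq ∘ suc))

basis : ∀ {n} → Fin n → Vector ℝ n
basis zero    = 1ℝ ∷ λ _ → 0ℝ
basis (suc i) = 0ℝ ∷ basis i

sumSq-0 : ∀ n → sumSq {n} (λ _ → 0ℚ) ≡ 0ℚ
sumSq-0 ℕ.zero    = refl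
sumSq-0 (ℕ.suc n) = cong (λ s → 0ℚ + s) (sumSq-0 n)

sumSq-basis : ∀ {n} (i : Fin n) m → sumSq (λ j → seq (basis i j) m) ≡ 1ℚ
sumSq-basis {ℕ.suc n} zero m = cong (λ s → 1ℚ + s) (sumSq-0 n)
sumSq-basis (suc i) m = cong (λ s → 0ℚ + s) (sumSq-basis i m)

-- Solves |u - eᵢ|² = |u|² - 2uᵢ + 1 for uᵢ. Recursion on `i` peels off coordinates at which eᵢ
-- vanishes; these contribute equally to both sums and cancel.
polarization : ∀ {n} (u : Vector ℚ n) i m →
  u i ≡ ½ * (sumSq u + 1ℚ - sumSq (λ j → u j - seq (basis i j) m))
polarization u zero m = trans
  (solve 2 (λ t s → t := con ½ :* (t :* t :+ s :+ con 1ℚ :- ((t :- con 1ℚ) :* (t :- con 1ℚ) :+ s))) refl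
    t (sumSq (u ∘ suc)))
  (cong (λ s → ½ * (t * t + sumSq (u ∘ suc) + 1ℚ - ((t - 1ℚ) * (t - 1ℚ) + s)))
    (sumSq-cong (λ j → sym (ℚₚ.+-identityʳ (u (suc j))))))
  where t = u zero
polarization u (suc i) m = trans (polarization (u ∘ suc) i m)
  (solve 3 (λ t s r → con ½ :* (s :+ con 1ℚ :- r) := con ½ :* (t :* t :+ s :+ con 1ℚ :- ((t :- con 0ℚ) :* (t :- con 0ℚ) :+ r))) refl
    (u zero) (sumSq (u ∘ suc)) (sumSq (λ j → u (suc j) - seq (basis i j) m)))

-- Polarization expresses the coordinate through two sums of squares, and each of these is recovered
-- from its norm by injectivity of the root.
coordinate-determined : ∀ {n} (x y : Vector ℝ n) i →
  ‖ x ‖ ≈ℝ ‖ y ‖ → ‖ x ⊖ basis i ‖ ≈ℝ ‖ y ⊖ basis i ‖ → x i ≈ℝ y i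
coordinate-determined x y i x≈y x-e≈y-e =
  ≈ℝ-trans {x i} {polar x} {y i} (≡⇒≈ℝ (x i) (polar x) (seq-polar x))
    (≈ℝ-trans {polar x} {polar y} {y i} polar-x≈polar-y
      (≡⇒≈ℝ (polar y) (y i) (λ m → sym (seq-polar y m))))
  where
  polar : Vector ℝ _ → ℝ
  polar z = fromℚ ½ *ℝ (∑² z +ℝ 1ℝ -ℝ ∑² (z ⊖ basis i))
  seq-polar : ∀ z m → seq (z i) m ≡ seq (polar z) m
  seq-polar z m = trans (polarization (λ j → seq (z j) m) i m)
    (cong₂ (λ s t → ½ * (s + 1ℚ - t)) (sym (seq-∑² z m)) (sym (seq-∑² (z ⊖ basis i) m)))
  polar-x≈polar-y : polar x ≈ℝ polar y
  polar-x≈polar-y = *ℝ-cong {fromℚ ½} {fromℚ ½} {∑² x +ℝ 1ℝ -ℝ ∑² (x ⊖ basis i)} {∑² y +ℝ 1ℝ -ℝ ∑² (y ⊖ basis i)}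
    (≈ℝ-refl {fromℚ ½})
    (+ℝ-cong {∑² x +ℝ 1ℝ} {∑² y +ℝ 1ℝ} { -ℝ ∑² (x ⊖ basis i)} { -ℝ ∑² (y ⊖ basis i)}
      (+ℝ-cong {∑² x} {∑² y} {1ℝ} {1ℝ} (∑²-injective x y x≈y) (≈ℝ-refl {1ℝ}))
      (-ℝ-cong {∑² (x ⊖ basis i)} {∑² (y ⊖ basis i)} (∑²-injective (x ⊖ basis i) (y ⊖ basis i) x-e≈y-e)))

-- Coordinate exchange and coordinate reflections.

record LinearInvolution (d : ℕ) : Set where
  field
    apply      : Vector ℝ d → Vector ℝ d
    apply-cong : ∀ {x y} → x ≋ y → apply x ≋ apply y
    involutive : ∀ x → apply (apply x) ≋ x
    -- These two fields stand for orthogonality and linearity: the first keeps the sphere invariant,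
    -- the second makes the map an isometry. Both are rational identities at each index `m`, within
    -- reach of the solver.
    apply-norm : ∀ x m → sumSq (λ i → seq (apply x i) m) ≡ sumSq (λ i → seq (x i) m)
    apply-⊖    : ∀ x y m → sumSq (λ i → seq (apply x i) m - seq (apply y i) m) ≡ sumSq (λ i → seq (x i) m - seq (y i) m)

  ‖apply‖ : ∀ x → ‖ apply x ‖ ≈ℝ ‖ x ‖
  ‖apply‖ x = √-cong {∑² (apply x)} {∑² x} (∑²-≈ (apply x) x (apply-norm x))

  ‖apply-⊖‖ : ∀ x y → ‖ apply x ⊖ apply y ‖ ≈ℝ ‖ x ⊖ y ‖
  ‖apply-⊖‖ x y = √-cong {∑² (apply x ⊖ apply y)} {∑² (x ⊖ y)} (∑²-≈ (apply x ⊖ apply y) (x ⊖ y) (apply-⊖ x y))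

open LinearInvolution

swapFirst : ∀ {k} → Vector ℝ (2 ℕ.+ k) → Vector ℝ (2 ℕ.+ k)
swapFirst x = x (suc zero) ∷ (x zero ∷ λ i → x (suc (suc i)))

swap : ∀ {k} → LinearInvolution (2 ℕ.+ k)
swap = record
  { apply      = swapFirst
  ; apply-cong = λ where
      p zero          → p (suc zero)
      p (suc zero)    → p zero
      p (suc (suc i)) → p (suc (suc i))
  ; involutive = λ where
      x zero          → ≈ℝ-refl {x zero}
      x (suc zero)    → ≈ℝ-refl {x (suc zero)}
      x (suc (suc i)) → ≈ℝ-refl {x (suc (suc i))}
  ; apply-norm = λ x m → exchange (λ i → seq (x i) m)
  ; apply-⊖    = λ x y m → exchange (λ i → seq (x i) m - seq (y i) m)
  }
  where
  exchange : ∀ {k} (u : Vector ℚ (2 ℕ.+ k)) →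
    u (suc zero) * u (suc zero) + (u zero * u zero + sumSq (λ i → u (suc (suc i)))) ≡ sumSq u
  exchange u = solve 3 (λ p q r → q :* q :+ (p :* p :+ r) := p :* p :+ (q :* q :+ r)) refl
    (u zero) (u (suc zero)) (sumSq (λ i → u (suc (suc i))))

flipAt : ∀ {d} → Fin d → Vector ℝ d → Vector ℝ d
flipAt i x = updateAt x i (λ t → -ℝ t)

flipAt-cong : ∀ {d} (i : Fin d) {x y} → x ≋ y → flipAt i x ≋ flipAt i y
flipAt-cong zero    {x} {y} p zero = -ℝ-cong {x zero} {y zero} (p zero)
flipAt-cong zero    p (suc j) = p (suc j)
flipAt-cong (suc i) p zero    = p zero
flipAt-cong (suc i) {x} {y} p (suc j) = flipAt-cong i {x ∘ suc} {y ∘ suc} (p ∘ suc) j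

flipAt-involutive : ∀ {d} (i : Fin d) x → flipAt i (flipAt i x) ≋ x
flipAt-involutive zero    x zero    = ≡⇒≈ℝ (-ℝ (-ℝ x zero)) (x zero) (λ m → solve 1 (λ t → :- (:- t) := t) refl (seq (x zero) m))
flipAt-involutive zero    x (suc j) = ≈ℝ-refl {x (suc j)}
flipAt-involutive (suc i) x zero    = ≈ℝ-refl {x zero}
flipAt-involutive (suc i) x (suc j) = flipAt-involutive i (x ∘ suc) j

flipAt-norm : ∀ {d} (i : Fin d) x m → sumSq (λ j → seq (flipAt i x j) m) ≡ sumSq (λ j → seq (x j) m)
flipAt-norm zero    x m = cong (λ p → p + sumSq (λ j → seq (x (suc j)) m))
  (solve 1 (λ t → (:- t) :* (:- t) := t :* t) refl (seq (x zero) m))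
flipAt-norm (suc i) x m = cong (λ s → seq (x zero) m * seq (x zero) m + s) (flipAt-norm i (x ∘ suc) m)

flipAt-⊖ : ∀ {d} (i : Fin d) x y m →
  sumSq (λ j → seq (flipAt i x j) m - seq (flipAt i y j) m) ≡ sumSq (λ j → seq (x j) m - seq (y j) m)
flipAt-⊖ zero    x y m = cong (λ p → p + sumSq (λ j → seq (x (suc j)) m - seq (y (suc j)) m))
  (solve 2 (λ s t → ((:- s) :- (:- t)) :* ((:- s) :- (:- t)) := (s :- t) :* (s :- t)) refl (seq (x zero) m) (seq (y zero) m))
flipAt-⊖ (suc i) x y m = cong (λ s → (seq (x zero) m - seq (y zero) m) * (seq (x zero) m - seq (y zero) m) + s)
  (flipAt-⊖ i (x ∘ suc) (y ∘ suc) m)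

flip : ∀ {d} → Fin d → LinearInvolution d
flip i = record
  { apply      = flipAt i
  ; apply-cong = flipAt-cong i
  ; involutive = flipAt-involutive i
  ; apply-norm = flipAt-norm i
  ; apply-⊖    = flipAt-⊖ i
  }

flipAt-fixed : ∀ {d} (i : Fin d) x → x i ≈ℝ 0ℝ → flipAt i x ≋ x
flipAt-fixed zero x p zero = ≈ℝ-trans { -ℝ x zero} { -ℝ 0ℝ} {x zero} (-ℝ-cong {x zero} {0ℝ} p)
  (≈ℝ-trans { -ℝ 0ℝ} {0ℝ} {x zero} (≡⇒≈ℝ (-ℝ 0ℝ) 0ℝ (λ _ → refl)) (≈ℝ-sym {x zero} {0ℝ} p))
flipAt-fixed zero    x p (suc j) = ≈ℝ-refl {x (suc j)}
flipAt-fixed (suc i) x p zero    = ≈ℝ-refl {x zero}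
flipAt-fixed (suc i) x p (suc j) = flipAt-fixed i (x ∘ suc) p j

swapFirst-fixed : ∀ {k} (x : Vector ℝ (2 ℕ.+ k)) → x zero ≈ℝ 0ℝ → x (suc zero) ≈ℝ 0ℝ → swapFirst x ≋ x
swapFirst-fixed x p q zero          = ≈ℝ-trans {x (suc zero)} {0ℝ} {x zero} q (≈ℝ-sym {x zero} {0ℝ} p)
swapFirst-fixed x p q (suc zero)    = ≈ℝ-trans {x zero} {0ℝ} {x (suc zero)} p (≈ℝ-sym {x (suc zero)} {0ℝ} q)
swapFirst-fixed x p q (suc (suc i)) = ≈ℝ-refl {x (suc (suc i))}

swapFirst-basis₀ : ∀ {k} → swapFirst {k} (basis zero) ≋ basis (suc zero)
swapFirst-basis₀ zero          = ≈ℝ-refl {0ℝ}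
swapFirst-basis₀ (suc zero)    = ≈ℝ-refl {1ℝ}
swapFirst-basis₀ (suc (suc i)) = ≈ℝ-refl {0ℝ}

swapFirst-basis₁ : ∀ {k} → swapFirst {k} (basis (suc zero)) ≋ basis zero
swapFirst-basis₁ zero          = ≈ℝ-refl {1ℝ}
swapFirst-basis₁ (suc zero)    = ≈ℝ-refl {0ℝ}
swapFirst-basis₁ (suc (suc i)) = ≈ℝ-refl {0ℝ}

-- The set `W` in coordinates.

≋-sym : ∀ {d} {x y : Vector ℝ d} → x ≋ y → y ≋ x
≋-sym {x = x} {y} p i = ≈ℝ-sym {x i} {y i} (p i)

≋-trans : ∀ {d} {x y z : Vector ℝ d} → x ≋ y → y ≋ z → x ≋ z
≋-trans {x = x} {y} {z} p q i = ≈ℝ-trans {x i} {y i} {z i} (p i) (q i)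

InW : ∀ {k} → Vector ℝ (2 ℕ.+ k) → Set
InW x = (x zero ≈ℝ 0ℝ × x (suc zero) ≈ℝ 0ℝ) ⊎ (x ≋ basis zero ⊎ x ≋ basis (suc zero))

InW-resp : ∀ {k} {x y : Vector ℝ (2 ℕ.+ k)} → x ≋ y → InW x → InW y
InW-resp {x = x} {y} p (inj₁ (q , r)) = inj₁
  (≈ℝ-trans {y zero} {x zero} {0ℝ} (≋-sym {x = x} {y} p zero) q , ≈ℝ-trans {y (suc zero)} {x (suc zero)} {0ℝ} (≋-sym {x = x} {y} p (suc zero)) r)
InW-resp {x = x} {y} p (inj₂ (inj₁ q)) = inj₂ (inj₁ (≋-trans {x = y} {x} {basis zero} (≋-sym {x = x} {y} p) q))
InW-resp {x = x} {y} p (inj₂ (inj₂ q)) = inj₂ (inj₂ (≋-trans {x = y} {x} {basis (suc zero)} (≋-sym {x = x} {y} p) q))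

basis-InW : ∀ {k} (i : Fin (2 ℕ.+ k)) → InW (basis i)
basis-InW zero          = inj₂ (inj₁ (λ i → ≈ℝ-refl {basis zero i}))
basis-InW (suc zero)    = inj₂ (inj₂ (λ i → ≈ℝ-refl {basis (suc zero) i}))
basis-InW (suc (suc i)) = inj₁ (≈ℝ-refl {0ℝ} , ≈ℝ-refl {0ℝ})

-- The common interface of ℝⁿ and Sⁿ. Two coordinates carry e₀ and e₁ and a third carries the Cantor
-- set, hence at least three. The spaces differ mainly in `determined`, where the norm of a point
-- must be known, and in `cantorPoint`.
record CoordinateSpace (k : ℕ) : Set₁ where
  field
    space : DistanceSpace
  open DistanceSpace space using (Carrier; _≈_; dist)
  field
    coords           : Carrier → Vector ℝ (3 ℕ.+ k)
    coords-cong      : ∀ {x y} → x ≈ y → coords x ≋ coords y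
    coords-injective : ∀ {x y} → coords x ≋ coords y → x ≈ y
    lift             : LinearInvolution (3 ℕ.+ k) → Carrier → Carrier
    coords-lift      : ∀ f x → coords (lift f x) ≡ apply f (coords x)
    unit             : Fin (3 ℕ.+ k) → Carrier
    coords-unit      : ∀ i → coords (unit i) ≡ basis i
    lift-isometric   : ∀ f x y → dist (lift f x) (lift f y) ≈ℝ dist x y
    determined       : ∀ x y → (∀ w → InW (coords w) → dist x w ≈ℝ dist y w) → coords x ≋ coords y
    cantorPoint      : ∀ α → ∃ λ x → (coords x zero ≈ℝ 0ℝ × coords x (suc zero) ≈ℝ 0ℝ) × coords x (suc (suc zero)) ≈ℝ cantor α

_≟_ : (c d : Color) → Dec (c ≡ d)
R ≟ R = yes refl
R ≟ B = no λ ()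
B ≟ R = no λ ()
B ≟ B = yes refl

-- The argument common to both spaces.

module Configuration {k : ℕ} (M : CoordinateSpace k) where
  open CoordinateSpace M
  private
    module X = DistanceSpace space
  open X using (Carrier; _≈_)

  W : Subset X.points
  W = record
    { member   = InW ∘ coords
    ; respects = λ {x} {y} p → InW-resp {x = coords x} {coords y} (coords-cong {x} {y} p)
    }

  -- For abstract `M` the fields `coords-lift` and `coords-unit` do not compute; here they are
  -- consumed by matching on the equations.
  ≈⇒ : ∀ {x y} {v w : Vector ℝ _} → coords x ≡ v → coords y ≡ w → v ≋ w → x ≈ y
  ≈⇒ {x} {y} refl refl p = coords-injective {x} {y} p

  lift-cong : ∀ f {x y} → x ≈ y → lift f x ≈ lift f y
  lift-cong f {x} {y} p = ≈⇒ (coords-lift f x) (coords-lift f y) (apply-cong f {coords x} {coords y} (coords-cong {x} {y} p))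

  lift-involutive : ∀ f x → lift f (lift f x) ≈ x
  lift-involutive f x = ≈⇒ (trans (coords-lift f (lift f x)) (cong (apply f) (coords-lift f x))) refl (involutive f (coords x))

  lift-inverse : ∀ f {x y} → y ≈ lift f x → lift f y ≈ x
  lift-inverse f {x} p = X.trans (lift-cong f p) (lift-involutive f x)

  isometry : LinearInvolution (3 ℕ.+ k) → Isometry space
  isometry f = record
    { bijection = record
      { to        = lift f
      ; from      = lift f
      ; to-cong   = lift-cong f
      ; from-cong = lift-cong f
      ; inverse   = lift-inverse f , lift-inverse f
      }
    ; isometric = lift-isometric f
    }

  -- If γ fixes w, then d(γx, w) = d(γx, γw) = d(x, w). So γx and x have equal distances to all of
  -- `W`, which determines the coordinates.
  trivialStabilizer : TrivialPointwiseStabilizer (isomAction space) W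
  trivialStabilizer γ fixes x = coords-injective {to x} {x} (determined (to x) x same-dist)
    where
    open Isometry γ using (to; isometric)
    same-dist : ∀ w → InW (coords w) → X.dist (to x) w ≈ℝ X.dist x w
    same-dist w w∈W = ≈ℝ-trans {X.dist (to x) w} {X.dist (to x) (to w)} {X.dist x w}
      (X.dist-cong X.refl (X.sym (fixes w w∈W))) (isometric x w)

  cantorW : (ℕ → Bool) → ∃ (Subset.member W)
  cantorW α = let (x , x∈L , _) = cantorPoint α in x , inj₁ x∈L

  digitsW : ∀ x α → x ≈ proj₁ (cantorW α) → ∀ n → digits (coords x (suc (suc zero))) n ≡ α n
  digitsW x α p n = digits-cantor n (coords x (suc (suc zero))) α
    (≈ℝ-trans {coords x (suc (suc zero))} {coords (proj₁ (cantorPoint α)) (suc (suc zero))} {cantor α}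
    (coords-cong {x} {proj₁ (cantorPoint α)} p (suc (suc zero))) (proj₂ (proj₂ (cantorPoint α))))

  -- If the diagonal point is listed at position m, the m-th digit read from that listed point
  -- equals its own negation. Emptiness, the other way to be countable, is refuted by any Cantor
  -- point.
  uncountable : Uncountable W
  uncountable (inj₁ empty) = let (x , x∈W) = cantorW (λ _ → true) in empty x x∈W
  uncountable (inj₂ enum) = not-¬ refl (digitsW (proj₁ (to m)) diagonal (proj₂ (surjective (cantorW diagonal)) refl) m)
    where
    open Surjection enum using (to; surjective)
    diagonal : ℕ → Bool
    diagonal n = not (digits (coords (proj₁ (to n)) (suc (suc zero))) n)
    m = proj₁ (surjective (cantorW diagonal))

  -- The i-th point has its only digit 1 at place i, so equal points have equal places.
  large : ∀ m → ∣ W ∣≥ m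
  large m = record
    { to        = cantorW ∘ indicator
    ; cong      = λ { refl → X.refl }
    ; injective = λ {i} {j} p → toℕ-injective (ℕₚ.≡ᵇ⇒≡ (toℕ i) (toℕ j) (subst T (separate i j p) (ℕₚ.≡⇒≡ᵇ (toℕ j) (toℕ j) refl)))
    }
    where
    indicator : Fin m → ℕ → Bool
    indicator i n = toℕ i ≡ᵇ n
    separate : ∀ i j → proj₁ (cantorW (indicator i)) ≈ proj₁ (cantorW (indicator j)) → indicator j (toℕ j) ≡ indicator i (toℕ j)
    separate i j p = trans (sym (digitsW (proj₁ (cantorW (indicator i))) (indicator j) p (toℕ j)))
      (digitsW (proj₁ (cantorW (indicator i))) (indicator i) X.refl (toℕ j))

  allRed : Precoloring W
  allRed = record { to = λ _ → R ; cong = λ _ → refl }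

  module _ (c : Coloring X.points) (ext : Extends W c allRed) where
    open Func c using () renaming (to to color; cong to color-cong)

    -- Membership in W is undecidable, but equality of colors is stable.
    preserved : ∀ f → (∀ x → InW (coords x) → color x ≡ B → color (lift f x) ≡ B) → ∀ x → color (lift f x) ≡ color x
    preserved f onW x = compare (color x) (color (lift f x)) refl refl
      where
      blue : ∀ y → color y ≡ B → color (lift f y) ≡ B
      blue y y-blue = decidable-stable (color (lift f y) ≟ B) λ ¬blue →
        contradiction (trans (sym (ext y (λ y∈W → ¬blue (onW y y∈W y-blue)))) y-blue) λ ()
      compare : ∀ a b → color x ≡ a → color (lift f x) ≡ b → color (lift f x) ≡ color x
      compare R R p q = trans q (sym p)
      compare B b p q = trans (blue x p) (sym p)
      -- Preserving blue suffices because f is an involution: a blue image of a red `x` would be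
      -- sent back to `x` and make it blue.
      compare R B p q = contradiction (trans (sym (blue (lift f x) q)) (trans (color-cong (lift-involutive f x)) p)) λ ()

    swap-preserves : color (unit zero) ≡ color (unit (suc zero)) → ∀ x → color (lift swap x) ≡ color x
    swap-preserves same = preserved swap onW
      where
      onW : ∀ x → InW (coords x) → color x ≡ B → color (lift swap x) ≡ B
      onW x (inj₁ (p , q)) x-blue = trans (color-cong (≈⇒ (coords-lift swap x) refl (swapFirst-fixed (coords x) p q))) x-blue
      onW x (inj₂ (inj₁ p)) x-blue = trans
        (color-cong (≈⇒ (coords-lift swap x) (coords-unit (suc zero))
          (≋-trans {x = swapFirst (coords x)} {swapFirst (basis zero)} {basis (suc zero)} (apply-cong swap {coords x} {basis zero} p) swapFirst-basis₀)))
        (trans (sym same) (trans (sym (color-cong (≈⇒ refl (coords-unit zero) p))) x-blue))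
      onW x (inj₂ (inj₂ p)) x-blue = trans
        (color-cong (≈⇒ (coords-lift swap x) (coords-unit zero)
          (≋-trans {x = swapFirst (coords x)} {swapFirst (basis (suc zero))} {basis zero} (apply-cong swap {coords x} {basis (suc zero)} p) swapFirst-basis₁)))
        (trans same (trans (sym (color-cong (≈⇒ refl (coords-unit (suc zero)) p))) x-blue))

    flip-preserves : ∀ i → (∀ x → InW (coords x) → color x ≡ B → coords x i ≈ℝ 0ℝ) → ∀ x → color (lift (flip i) x) ≡ color x
    flip-preserves i vanishes = preserved (flip i) λ x x∈W x-blue →
      trans (color-cong (≈⇒ (coords-lift (flip i) x) refl (flipAt-fixed i (coords x) (vanishes x x∈W x-blue)))) x-blue

    red≉blue : ∀ {x i} → color (unit i) ≡ R → coords x ≋ basis i → ¬ color x ≡ B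
    red≉blue {x} {i} red p blue =
      contradiction (trans (sym blue) (trans (color-cong (≈⇒ refl (coords-unit i) p)) red)) λ ()

    -- A distinguishing coloring preserved by f would force f to be the identity, yet f changes a
    -- coordinate of eᵢ.
    moved : ∀ f i j → ¬ apply f (basis i) j ≈ℝ basis i j → Distinguishing (isomAction space) c → ¬ (∀ x → color (lift f x) ≡ color x)
    moved f i j moves dist pres = moves (subst₂ (λ u v → u j ≈ℝ v j)
      (trans (coords-lift f (unit i)) (cong (apply f) (coords-unit i))) (coords-unit i)
      (coords-cong {lift f (unit i)} {unit i} (dist (isometry f) pres (unit i)) j))

    notDistinguishing : ¬ Distinguishing (isomAction space) c
    notDistinguishing dist = compare (color (unit zero)) (color (unit (suc zero))) refl refl
      where
      swapped : color (unit zero) ≡ color (unit (suc zero)) → ⊥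
      swapped same = moved swap zero zero 0≉1 dist (swap-preserves same)
      compare : ∀ a b → color (unit zero) ≡ a → color (unit (suc zero)) ≡ b → ⊥
      compare R R p q = swapped (trans p (sym q))
      compare B B p q = swapped (trans p (sym q))
      compare R B p q = moved (flip zero) zero zero -1≉1 dist (flip-preserves zero λ where
        x (inj₁ (x₀≈0 , _))   _      → x₀≈0
        x (inj₂ (inj₁ x≈e₀)) x-blue → contradiction x-blue (red≉blue p x≈e₀)
        x (inj₂ (inj₂ x≈e₁)) _      → x≈e₁ zero)
      compare B R p q = moved (flip (suc zero)) (suc zero) (suc zero) -1≉1 dist (flip-preserves (suc zero) λ where
        x (inj₁ (_ , x₁≈0))   _      → x₁≈0
        x (inj₂ (inj₁ x≈e₀)) _      → x≈e₀ (suc zero)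
        x (inj₂ (inj₂ x≈e₁)) x-blue → contradiction x-blue (red≉blue q x≈e₁))

  ¬P : ¬ P (isomAction space) W
  ¬P pW = let (c , ext , dist) = pW allRed in notDistinguishing c ext dist

  -- The space is passed with an equation because n equals 3 + (n ∸ 3) only propositionally;
  -- matching on it replaces `X` everywhere at once.
  conclusion : ∀ X → X ≡ space →
    (∃ λ (W : Subset (DistanceSpace.points X)) →
      Uncountable W ×
      TrivialPointwiseStabilizer (isomAction X) W ×
      ¬ P (isomAction X) W ×
      (∃ λ (p : Precoloring W) → (c : Coloring (DistanceSpace.points X)) →
        Extends W c p → ¬ Distinguishing (isomAction X) c)) ×
    ExtD≡ (isomAction X) ⊤⁺
  conclusion _ refl = (W , uncountable , trivialStabilizer , ¬P , allRed , notDistinguishing) ,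
    -- The same `W` refutes every finite bound, since it has at least m points for each m.
    λ m bound → ¬P (bound W (large m) trivialStabilizer)

-- Euclidean space.

euclideanCoordinates : ∀ k → CoordinateSpace k
euclideanCoordinates k = record
  { space            = Euclidean (3 ℕ.+ k)
  ; coords           = λ x → x
  ; coords-cong      = λ p → p
  ; coords-injective = λ p → p
  ; lift             = apply
  ; coords-lift      = λ f x → refl
  ; unit             = basis
  ; coords-unit      = λ i → refl
  ; lift-isometric   = ‖apply-⊖‖
  -- The origin lies in `W`, so distances to it give equality of the norms.
  ; determined       = λ x y same-dist i → coordinate-determined x y i
      (≈ℝ-trans {‖ x ‖} {‖ x ⊖ origin ‖} {‖ y ‖} (≈ℝ-sym {‖ x ⊖ origin ‖} {‖ x ‖} (‖⊖0‖ x))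
        (≈ℝ-trans {‖ x ⊖ origin ‖} {‖ y ⊖ origin ‖} {‖ y ‖} (same-dist origin (inj₁ (≈ℝ-refl {0ℝ} , ≈ℝ-refl {0ℝ}))) (‖⊖0‖ y)))
      (same-dist (basis i) (basis-InW i))
  ; cantorPoint      = λ α → (0ℝ ∷ (0ℝ ∷ (cantor α ∷ λ _ → 0ℝ))) ,
      (≈ℝ-refl {0ℝ} , ≈ℝ-refl {0ℝ}) , ≈ℝ-refl {cantor α}
  }
  where
  origin : Vector ℝ (3 ℕ.+ k)
  origin _ = 0ℝ
  ‖⊖0‖ : ∀ (x : Vector ℝ (3 ℕ.+ k)) → ‖ x ⊖ origin ‖ ≈ℝ ‖ x ‖
  ‖⊖0‖ x = √-cong {∑² (x ⊖ origin)} {∑² x} (∑²-≈ (x ⊖ origin) x λ m → sumSq-cong (λ i → ℚₚ.+-identityʳ (seq (x i) m)))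

-- The unit sphere.

∑²≈1⇒‖‖≈1 : ∀ {n} (x : Vector ℝ n) → ∑² x ≈ℝ 1ℝ → ‖ x ‖ ≈ℝ 1ℝ
∑²≈1⇒‖‖≈1 x p = ≈ℝ-trans {‖ x ‖} {√ 1ℝ} {1ℝ} (√-cong {∑² x} {1ℝ} p) √1≈1

‖basis‖≈1 : ∀ {n} (i : Fin n) → ‖ basis i ‖ ≈ℝ 1ℝ
‖basis‖≈1 i = ∑²≈1⇒‖‖≈1 (basis i) (≡⇒≈ℝ (∑² (basis i)) 1ℝ (λ m → trans (seq-∑² (basis i) m) (sumSq-basis i m)))

-- The fourth coordinate normalizes the vector while the third stays free to carry the digits.
cantorSphere : ∀ k → (ℕ → Bool) → Vector ℝ (4 ℕ.+ k)
cantorSphere k α = 0ℝ ∷ (0ℝ ∷ (cantor α ∷ ((√ (1ℝ -ℝ cantor α *ℝ cantor α)) ∷ λ _ → 0ℝ)))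

cantorSphere-norm : ∀ k α → ‖ cantorSphere k α ‖ ≈ℝ 1ℝ
cantorSphere-norm k α = ∑²≈1⇒‖‖≈1 (cantorSphere k α)
  (≈ℝ-trans {∑² (cantorSphere k α)} {s *ℝ s +ℝ r *ℝ r} {1ℝ}
    (≡⇒≈ℝ (∑² (cantorSphere k α)) (s *ℝ s +ℝ r *ℝ r) λ m → trans (trans (seq-∑² (cantorSphere k α) m)
      (cong (λ z → 0ℚ * 0ℚ + (0ℚ * 0ℚ + (seq s m * seq s m + (seq r m * seq r m + z)))) (sumSq-0 k)))
      (solve 2 (λ a b → con 0ℚ :* con 0ℚ :+ (con 0ℚ :* con 0ℚ :+ (a :* a :+ (b :* b :+ con 0ℚ))) := a :* a :+ b :* b) refl (seq s m) (seq r m)))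
    (≈ℝ-trans {s *ℝ s +ℝ r *ℝ r} {s *ℝ s +ℝ y} {1ℝ}
      (+ℝ-cong {s *ℝ s} {s *ℝ s} {r *ℝ r} {y} (≈ℝ-refl {s *ℝ s}) (√²≈ y 0≤y))
      (≡⇒≈ℝ (s *ℝ s +ℝ y) 1ℝ λ m → solve 1 (λ t → t :* t :+ (con 1ℚ :- t :* t) := con 1ℚ) refl (seq s m))))
  where
  s = cantor α
  y = 1ℝ -ℝ s *ℝ s
  r = √ y
  0≤y : NonNegative y
  -- Every partial sum, not only the limit, lies in [0, ½], which gives the termwise nonnegativity
  -- that `√²≈` requires.
  0≤y m = ℚₚ.+-mono-≤ {1ℚ} {1ℚ} { - 1ℚ} ℚₚ.≤-refl (ℚₚ.neg-antimono-≤ t²≤1)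
    where
    t = seq s m
    t²≤1 : t * t ≤ℚ 1ℚ
    t²≤1 = ℚₚ.≤-trans (ℚₚ.*-monoˡ-≤-nonNeg t {{ℚ.nonNegative (0≤cantorSum m α)}} (cantorSum≤½ m α))
      (ℚₚ.≤-trans (ℚₚ.*-monoʳ-≤-nonNeg ½ (cantorSum≤½ m α)) (from-yes (½ * ½ ℚₚ.≤? 1ℚ)))

module _ {n : ℕ} where
  open DistanceSpace (Sphere n) using (Carrier; dist)

  sphereLift : LinearInvolution (ℕ.suc n) → Carrier → Carrier
  sphereLift f (x , ‖x‖≈1) = apply f x , ≈ℝ-trans {‖ apply f x ‖} {‖ x ‖} {1ℝ} (‖apply‖ f x) ‖x‖≈1

  coords-sphereLift : ∀ f x → proj₁ (sphereLift f x) ≡ apply f (proj₁ x)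
  coords-sphereLift f x = refl

  sphereLift-isometric : ∀ f x y → dist (sphereLift f x) (sphereLift f y) ≈ℝ dist x y
  sphereLift-isometric f x y = subst₂ (λ u v → ‖ u ⊖ v ‖ ≈ℝ ‖ proj₁ x ⊖ proj₁ y ‖)
    (sym (coords-sphereLift f x)) (sym (coords-sphereLift f y)) (‖apply-⊖‖ f (proj₁ x) (proj₁ y))

  sphereBasis : Fin (ℕ.suc n) → Carrier
  sphereBasis i = basis i , ‖basis‖≈1 i

  coords-sphereBasis : ∀ i → proj₁ (sphereBasis i) ≡ basis i
  coords-sphereBasis i = refl

  sphere-determined : ∀ x y → (∀ i → dist x (sphereBasis i) ≈ℝ dist y (sphereBasis i)) → proj₁ x ≋ proj₁ y
  sphere-determined x y same-dist i = coordinate-determined (proj₁ x) (proj₁ y) i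
    (≈ℝ-trans {‖ proj₁ x ‖} {1ℝ} {‖ proj₁ y ‖} (proj₂ x) (≈ℝ-sym {‖ proj₁ y ‖} {1ℝ} (proj₂ y)))
    (subst (λ e → ‖ proj₁ x ⊖ e ‖ ≈ℝ ‖ proj₁ y ⊖ e ‖) (coords-sphereBasis i) (same-dist i))

-- The sphere of dimension 3 + k has 4 + k coordinates, whence the index `ℕ.suc k`. All norms are 1,
-- so distances to the basis vectors determine a point.
sphereCoordinates : ∀ k → CoordinateSpace (ℕ.suc k)
sphereCoordinates k = record
  { space            = Sphere (3 ℕ.+ k)
  ; coords           = proj₁
  ; coords-cong      = λ p → p
  ; coords-injective = λ p → p
  ; lift             = sphereLift
  ; coords-lift      = coords-sphereLift
  ; unit             = sphereBasis
  ; coords-unit      = coords-sphereBasis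
  ; lift-isometric   = sphereLift-isometric
  ; determined       = λ x y same-dist → sphere-determined x y (λ i → same-dist (sphereBasis i) (basis-InW i))
  ; cantorPoint      = λ α → (cantorSphere k α , cantorSphere-norm k α) ,
      (≈ℝ-refl {0ℝ} , ≈ℝ-refl {0ℝ}) , ≈ℝ-refl {cantor α}
  }

-- Passage from n ≥ 3 to the form 3 + k.

euclidean≡space : ∀ k → Euclidean (3 ℕ.+ k) ≡ CoordinateSpace.space (euclideanCoordinates k)
euclidean≡space k = refl

sphere≡space : ∀ k → Sphere (3 ℕ.+ k) ≡ CoordinateSpace.space (sphereCoordinates k)
sphere≡space k = refl

n≡3+[n∸3] : ∀ {n} → 3 ≤ n → n ≡ 3 ℕ.+ (n ∸ 3)
n≡3+[n∸3] 3≤n = sym (ℕₚ.m+[n∸m]≡n 3≤n)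

theorem2 : (n : ℕ) → 3 ≤ n → (X : DistanceSpace) → X ≡ Euclidean n ⊎ X ≡ Sphere n →
    (∃ λ (W : Subset (DistanceSpace.points X)) →
    Uncountable W ×
    TrivialPointwiseStabilizer (isomAction X) W ×
    ¬ P (isomAction X) W ×
    (∃ λ (p : Precoloring W) → (c : Coloring (DistanceSpace.points X)) →
    Extends W c p → ¬ Distinguishing (isomAction X) c)) ×
    ExtD≡ (isomAction X) ⊤⁺
theorem2 n 3≤n X (inj₁ X≡ℝⁿ) = Configuration.conclusion (euclideanCoordinates (n ∸ 3)) X
  (trans X≡ℝⁿ (trans (cong Euclidean (n≡3+[n∸3] 3≤n)) (euclidean≡space (n ∸ 3))))
theorem2 n 3≤n X (inj₂ X≡Sⁿ) = Configuration.conclusion (sphereCoordinates (n ∸ 3)) X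
  (trans X≡Sⁿ (trans (cong Sphere (n≡3+[n∸3] 3≤n)) (sphere≡space (n ∸ 3))))
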